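{- Let $s \geq 2$ and $n \geq k \geq 5$ be integers, and let $t = \lfloor \frac{k-1}{2}\rfloor$. If $G$ is a 2-connected graph on $n$ vertices with circumference less than $k$ (i.e., $G$ contains no cycle of length $k$ or greater), then \[N_s(G) \leq \max\{f_s(n, k, 2),\ f_s(n, k, t)\},\] where $f_s(n,k,a) = \binom{k-a}{s} + (n-k+a)\binom{a}{s-1}$.
   Context: For an integer $s \geq 2$ and a graph $G$, $N_s(G)$ denotes the number of (unlabeled) copies of the complete graph $K_s$ in $G$, i.e., the number of $s$-element vertex subsets of $G$ that induce a clique; in particular $N_2(G)$ is the number of edges. The circumference of a graph is the length of its longest cycle. For integers $n,k,a$, $f_s(n,k,a) := \binom{k-a}{s} + (n-k+a)\binom{a}{s-1}$. -}

module Defs where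

open import Data.Nat using (ℕ; zero; suc; _+_; _*_; _∸_; _≤_; _<_)
open import Data.Bool using (Bool; true; false; _∧_; _∨_; not)
open import Data.Fin using (Fin; toℕ; _≟_)
open import Data.Vec using (Vec; []; _∷_; lookup)
open import Data.List using (List; [_]; map; _++_; filterᵇ; length; allFin)
open import Data.Bool.ListAction using (and)
open import Data.Fin.Subset using (Subset; ∣_∣)
open import Data.Nat.Combinatorics using (_C_)
open import Data.Product using (Σ; _×_)
open import Function.Definitions using (Injective)
open import Relation.Binary.PropositionalEquality using (_≡_; _≢_)
open import Relation.Nullary.Decidable using (⌊_⌋)

record Graph (n : ℕ) : Set where
  field
    adj    : Fin n → Fin n → Bool
    sym    : ∀ i j → adj i j ≡ adj j i
    irrefl : ∀ i → adj i i ≡ false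
open Graph public

Adj : ∀ {n} → Graph n → Fin n → Fin n → Set
Adj G i j = adj G i j ≡ true

data WalkAvoiding {n} (G : Graph n) (w : Fin n) : Fin n → Fin n → Set where
  here : ∀ {u} → WalkAvoiding G w u u
  step : ∀ {u x v} → Adj G u x → x ≢ w → WalkAvoiding G w x v → WalkAvoiding G w u v

TwoConnected : ∀ {n} → Graph n → Set
TwoConnected {n} G =
  3 ≤ n × (∀ (w u v : Fin n) → u ≢ w → v ≢ w → WalkAvoiding G w u v)

HasCycleOfLength : ∀ {n} → Graph n → ℕ → Set
HasCycleOfLength {n} G ℓ =
  3 ≤ ℓ × Σ (Fin ℓ → Fin n) (λ c →
    Injective _≡_ _≡_ c
    × (∀ (i j : Fin ℓ) → toℕ j ≡ suc (toℕ i) → Adj G (c i) (c j))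
    × (∀ (i j : Fin ℓ) → toℕ i ≡ 0 → suc (toℕ j) ≡ ℓ → Adj G (c j) (c i)))

CircumferenceLessThan : ∀ {n} → Graph n → ℕ → Set
CircumferenceLessThan G k = ∀ ℓ → HasCycleOfLength G ℓ → ℓ < k

allSubsets : ∀ n → List (Subset n)
allSubsets zero = [ [] ]
allSubsets (suc n) = map (true ∷_) (allSubsets n) ++ map (false ∷_) (allSubsets n)

isClique : ∀ {n} → Graph n → Subset n → Bool
isClique {n} G S =
  and (map (λ i → and (map (λ j →
        not (lookup S i ∧ lookup S j) ∨ ⌊ i ≟ j ⌋ ∨ adj G i j)
      (allFin n))) (allFin n))

isSClique : ∀ {n} → Graph n → ℕ → Subset n → Bool
isSClique G s S = ⌊ ∣ S ∣ Data.Nat.≟ s ⌋ ∧ isClique G S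

N : ∀ {n} → ℕ → Graph n → ℕ
N s G = length (filterᵇ (isSClique G s) (allSubsets _))

f : ℕ → ℕ → ℕ → ℕ → ℕ
f s n k a = ((k ∸ a) C s) + ((n ∸ k) + a) * (a C (s ∸ 1))

{-# OPTIONS --safe #-}
module Submission where

-- Kopylov's method. Assume G violates the bound and add edges as long as no long cycle appears, so
-- that any two nonadjacent vertices are joined by a path on at least k vertices. Let H be what is left
-- after repeatedly deleting vertices with at most t remaining neighbours. If H is empty, each of
-- the first n − k + t deletions destroys at most t C (s − 1) cliques, which gives f s n k t. Otherwise
-- a longest path between nonadjacent vertices of H would, by Kopylov's lemma, close up to a cycle of
-- length at least k; so H is a clique, with r < k vertices. The same argument between H and the set
-- left after deleting with threshold k − r shows that this set lies in H, giving f s n k (k − r)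
-- with 2 ≤ k − r ≤ t, and f is convex in its last argument.

open import Defs hiding (sym)
open import Data.Nat
  using (ℕ; zero; suc; _+_; _*_; _∸_; _/_; _%_; _≤_; _<_; _⊔_; _≤′_; ≤′-refl; ≤′-step; z≤n; s≤s; _≤?_; _<?_)
open import Data.Nat.Properties
open import Data.Nat.DivMod using (m≡m%n+[m/n]*n; m%n<n; m/n*n≤m)
open import Data.Nat.Combinatorics using (_C_; nCn≡1; nCk≡nC[n∸k]; nCk+nC[k+1]≡[n+1]C[k+1])
open import Data.Nat.Combinatorics.Specification using (k>n⇒nCk≡0)
open import Data.Nat.Tactic.RingSolver using (solve-∀)
open import Data.Bool using (Bool; true; false; _∧_; _∨_; not)
import Data.Bool.Properties as Bool
open import Data.Bool.ListAction using (and)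
open import Data.Fin as Fin using (Fin; zero; suc; toℕ)
open import Data.Fin.Subset using (Subset; ∣_∣)
import Data.Vec as Vec
open import Data.List
  using (List; []; _∷_; _++_; [_]; length; reverse; filterᵇ; lookup; tabulate; allFin; map; cartesianProduct)
open import Data.List.Properties using (++-assoc; length-++; length-reverse; length-tabulate; unfold-reverse; filter-++)
import Data.List.Membership.DecPropositional as DecMembership
open import Data.List.Membership.Propositional using (_∈_; _∉_)
open import Data.List.Membership.Propositional.Properties
  using (∈-++⁺ˡ; ∈-++⁺ʳ; ∈-++⁻; ∈-∃++; ∈-allFin; ∈-lookup; ∈-cartesianProduct⁺)
open import Data.List.Relation.Unary.Any using (here; there)
open import Data.List.Relation.Unary.Any.Properties using (reverse⁺; reverse⁻)
open import Data.List.Relation.Unary.All using ([]; _∷_)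
open import Data.List.Relation.Unary.All.Properties using (All¬⇒¬Any; ¬Any⇒All¬)
open import Data.List.Relation.Unary.AllPairs using ([]; _∷_)
open import Data.List.Relation.Unary.Unique.Propositional using (Unique)
import Data.List.Relation.Unary.Unique.Propositional.Properties as Unique
open import Data.List.Relation.Binary.Permutation.Propositional using (_↭_; refl; prep; swap; module _↭_)
open import Data.List.Relation.Binary.Permutation.Propositional.Properties using (filter-↭; shift; ↭-length)
open import Data.Product using (∃; ∃₂; _×_; _,_; proj₁; proj₂)
open import Data.Sum using (_⊎_; inj₁; inj₂; [_,_]′)
open import Data.Empty using (⊥; ⊥-elim)
open import Function using (_∘_)
open import Relation.Nullary using (¬_; Dec; yes; no; ¬?; _×-dec_)
open import Relation.Nullary.Decidable using (⌊_⌋)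
open import Relation.Unary using (Decidable)
open import Relation.Binary.PropositionalEquality
  using (_≡_; _≢_; refl; sym; trans; cong; cong₂; subst; subst₂; module ≡-Reasoning)

-- Lists and walks

-- The hard step is Kopylov's lemma: a path from x to y with at least k vertices, whose ends
-- together have at least k neighbours on it, yields a cycle of length at least k. If some neighbour
-- of y precedes a neighbour of x on the path, two chords close the path up, and the degree sum
-- controls how much of it is lost. If no neighbour of y precedes one of x, chords at x and y alone
-- produce nothing, and 2-connectedness has to supply the cycle. One bypass around the vertex
-- between the two neighbourhoods may fall short of the neighbours of y, so bypasses are chained
-- until one does not. The saturated graph is never constructed. The induction is on the number of
-- missing edges: if the bound fails for G, joining a nonadjacent pair must create a long cycle,
-- since otherwise the larger graph, and with it G, would satisfy the bound.

module _ {A : Set} where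

  Disj : List A → List A → Set
  Disj xs ys = ∀ {v} → v ∈ xs → v ∈ ys → ⊥

  infix 4 _⊆_
  _⊆_ : List A → List A → Set
  xs ⊆ ys = ∀ {v} → v ∈ xs → v ∈ ys

  unique-∷⁻ : ∀ {x : A} {xs} → Unique (x ∷ xs) → x ∉ xs × Unique xs
  unique-∷⁻ (p ∷ u) = All¬⇒¬Any p , u

  unique-∷⁺ : ∀ {x : A} {xs} → x ∉ xs → Unique xs → Unique (x ∷ xs)
  unique-∷⁺ x∉ u = ¬Any⇒All¬ _ x∉ ∷ u

  unique-++⁺ : ∀ {xs ys : List A} → Unique xs → Unique ys → Disj xs ys → Unique (xs ++ ys)
  unique-++⁺ u v d = Unique.++⁺ u v λ (a , b) → d a b

  unique-++⁻ : ∀ (xs {ys} : List A) → Unique (xs ++ ys) → Unique xs × Unique ys × Disj xs ys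
  unique-++⁻ [] u = [] , u , λ ()
  unique-++⁻ (x ∷ xs) u with unique-∷⁻ u
  ... | x∉ , u′ with unique-++⁻ xs u′
  ... | ux , uy , d = unique-∷⁺ (x∉ ∘ ∈-++⁺ˡ) ux , uy
      , λ { (here refl) b → x∉ (∈-++⁺ʳ xs b) ; (there a) b → d a b }

  unique-reverse : ∀ {xs : List A} → Unique xs → Unique (reverse xs)
  unique-reverse {[]} u = u
  unique-reverse {x ∷ xs} u with unique-∷⁻ u
  ... | x∉ , u′ = subst Unique (sym (unfold-reverse x xs))
      (unique-++⁺ (unique-reverse u′) ([] ∷ []) λ { a (here refl) → x∉ (reverse⁻ a) })

  length-⊆ : ∀ {xs ys : List A} → Unique xs → xs ⊆ ys → length xs ≤ length ys
  length-⊆ {[]} u sub = z≤n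
  length-⊆ {x ∷ xs} u sub with ∈-∃++ (sub (here refl)) | unique-∷⁻ u
  ... | as , bs , refl | x∉ , u′ = begin
      suc (length xs)             ≤⟨ s≤s (length-⊆ u′ sub′) ⟩
      suc (length (as ++ bs))     ≡⟨ cong suc (length-++ as) ⟩
      suc (length as + length bs) ≡⟨ sym (+-suc (length as) (length bs)) ⟩
      length as + suc (length bs) ≡⟨ sym (length-++ as) ⟩
      length (as ++ x ∷ bs)       ∎
    where
    open ≤-Reasoning
    sub′ : xs ⊆ as ++ bs
    sub′ m with ∈-++⁻ as (sub (there m))
    ... | inj₁ a = ∈-++⁺ˡ a
    ... | inj₂ (here refl) = ⊥-elim (x∉ m)
    ... | inj₂ (there b) = ∈-++⁺ʳ as b

  module _ {P : A → Set} (P? : Decidable P) where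

    None : List A → Set
    None xs = ∀ {v} → v ∈ xs → ¬ P v

    splitFirst : ∀ xs → (∃ λ ys → ∃₂ λ z zs → xs ≡ ys ++ z ∷ zs × P z × None ys) ⊎ None xs
    splitFirst [] = inj₂ λ ()
    splitFirst (x ∷ xs) with P? x | splitFirst xs
    ... | yes p | _ = inj₁ ([] , x , xs , refl , p , λ ())
    ... | no ¬p | inj₁ (ys , z , zs , eq , p , none) =
      inj₁ (x ∷ ys , z , zs , cong (x ∷_) eq , p , λ { (here refl) → ¬p ; (there m) → none m })
    ... | no ¬p | inj₂ none = inj₂ λ { (here refl) → ¬p ; (there m) → none m }

    splitLast : ∀ xs → (∃ λ ys → ∃₂ λ z zs → xs ≡ ys ++ z ∷ zs × P z × None zs) ⊎ None xs
    splitLast [] = inj₂ λ ()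
    splitLast (x ∷ xs) with splitLast xs | P? x
    ... | inj₁ (ys , z , zs , eq , p , none) | _ = inj₁ (x ∷ ys , z , zs , cong (x ∷_) eq , p , none)
    ... | inj₂ none | yes p = inj₁ ([] , x , xs , refl , p , none)
    ... | inj₂ none | no ¬p = inj₂ λ { (here refl) → ¬p ; (there m) → none m }

    splitFirst∈ : ∀ {v xs} → v ∈ xs → P v → ∃ λ ys → ∃₂ λ z zs → xs ≡ ys ++ z ∷ zs × P z × None ys
    splitFirst∈ {xs = xs} m p with splitFirst xs
    ... | inj₁ r = r
    ... | inj₂ none = ⊥-elim (none m p)

    splitLast∈ : ∀ {v xs} → v ∈ xs → P v → ∃ λ ys → ∃₂ λ z zs → xs ≡ ys ++ z ∷ zs × P z × None zs
    splitLast∈ {xs = xs} m p with splitLast xs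
    ... | inj₁ r = r
    ... | inj₂ none = ⊥-elim (none m p)

  count : (A → Bool) → List A → ℕ
  count p xs = length (filterᵇ p xs)

  ∈-filterᵇ⁺ : ∀ (p : A → Bool) {v xs} → v ∈ xs → p v ≡ true → v ∈ filterᵇ p xs
  ∈-filterᵇ⁺ p {xs = x ∷ xs} (here refl) q rewrite q = here refl
  ∈-filterᵇ⁺ p {xs = x ∷ xs} (there m) q with p x
  ... | true = there (∈-filterᵇ⁺ p m q)
  ... | false = ∈-filterᵇ⁺ p m q

  ∈-filterᵇ⁻ : ∀ (p : A → Bool) {v} xs → v ∈ filterᵇ p xs → v ∈ xs × p v ≡ true
  ∈-filterᵇ⁻ p (x ∷ xs) m with p x in eq
  ∈-filterᵇ⁻ p (x ∷ xs) (here refl) | true = here refl , eq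
  ∈-filterᵇ⁻ p (x ∷ xs) (there m)   | true with ∈-filterᵇ⁻ p xs m
  ... | a , b = there a , b
  ∈-filterᵇ⁻ p (x ∷ xs) m | false with ∈-filterᵇ⁻ p xs m
  ... | a , b = there a , b

  unique-filterᵇ : ∀ (p : A → Bool) {xs} → Unique xs → Unique (filterᵇ p xs)
  unique-filterᵇ p = Unique.filter⁺ _

  count-⊆ : ∀ (p : A → Bool) {xs ys} → Unique xs → xs ⊆ ys → count p xs ≤ count p ys
  count-⊆ p {xs} u sub = length-⊆ (unique-filterᵇ p u) λ m →
    let a , b = ∈-filterᵇ⁻ p xs m in ∈-filterᵇ⁺ p (sub a) b

  count-++ : ∀ (p : A → Bool) xs ys → count p (xs ++ ys) ≡ count p xs + count p ys
  count-++ p xs ys = trans (cong length (filter-++ _ xs ys)) (length-++ (filterᵇ p xs))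

  count-none : ∀ (p : A → Bool) {xs} → (∀ {v} → v ∈ xs → p v ≢ true) → count p xs ≡ 0
  count-none p {[]} h = refl
  count-none p {x ∷ xs} h with p x in eq
  ... | true = ⊥-elim (h (here refl) eq)
  ... | false = count-none p (h ∘ there)

  -- The index lists all vertices, both ends included. Being a path is then `Unique` of that list,
  -- and its `length` is directly comparable with `k`.
  data Walk (R : A → A → Set) : A → List A → A → Set where
    end : ∀ {u} → Walk R u [ u ] u
    _◂_ : ∀ {u w v xs} → R u w → Walk R w xs v → Walk R u (u ∷ xs) v
  infixr 5 _◂_

module _ {A : Set} {R : A → A → Set} where

  walk-head : ∀ {u v xs} → Walk R u xs v → ∃ λ ys → xs ≡ u ∷ ys
  walk-head end = _ , refl
  walk-head (_ ◂ _) = _ , refl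

  head∈ : ∀ {u v xs} → Walk R u xs v → u ∈ xs
  head∈ end = here refl
  head∈ (_ ◂ _) = here refl

  last∈ : ∀ {u v xs} → Walk R u xs v → v ∈ xs
  last∈ end = here refl
  last∈ (_ ◂ p) = there (last∈ p)

  append : ∀ {u v w z xs ys} → Walk R u xs v → R v w → Walk R w ys z → Walk R u (xs ++ ys) z
  append end e q = e ◂ q
  append (e′ ◂ p) e q = e′ ◂ append p e q

  join : ∀ {u v w xs ys} → Walk R u xs v → Walk R v (v ∷ ys) w → Walk R u (xs ++ ys) w
  join end q = q
  join (e ◂ p) q = e ◂ join p q

  split : ∀ {u v z} xs {ys} → Walk R u (xs ++ z ∷ ys) v → Walk R u (xs ++ [ z ]) z × Walk R z (z ∷ ys) v
  split [] end = end , end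
  split [] (e ◂ p) = end , e ◂ p
  split (x ∷ []) (e ◂ p) with split [] p
  ... | a , b = e ◂ a , b
  split (x ∷ xs@(_ ∷ _)) (e ◂ p) with split xs p
  ... | a , b = e ◂ a , b

  splitEdge : ∀ {u v z w} xs {ys} → Walk R u (xs ++ z ∷ w ∷ ys) v →
              Walk R u (xs ++ [ z ]) z × R z w × Walk R w (w ∷ ys) v
  splitEdge xs p with split xs p
  ... | a , (e ◂ end) = a , e , end
  ... | a , (e ◂ (e′ ◂ q)) = a , e , e′ ◂ q

  lastEdge : ∀ {u v z} xs → Walk R u (xs ++ [ z ]) v → z ≡ v × (u ≡ z ⊎ ∃ λ w → w ∈ xs × R w z)
  lastEdge [] end = refl , inj₁ refl
  lastEdge [] (_ ◂ ())
  lastEdge (x ∷ []) (e ◂ end) = refl , inj₂ (_ , here refl , e)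
  lastEdge (x ∷ []) (e ◂ (_ ◂ ()))
  lastEdge (x ∷ xs@(_ ∷ _)) (e ◂ p) with lastEdge xs p
  ... | eq , inj₂ (w , m , e′) = eq , inj₂ (w , there m , e′)
  ... | eq , inj₁ refl with walk-head p
  ... | _ , refl = eq , inj₂ (_ , here refl , e)

  walk-reverse : (∀ {u v} → R u v → R v u) → ∀ {u v xs} → Walk R u xs v → Walk R v (reverse xs) u
  walk-reverse s end = end
  walk-reverse s (_◂_ {u} {xs = xs} e p) =
    subst (λ l → Walk R _ l _) (sym (unfold-reverse u xs)) (append (walk-reverse s p) (s e) end)

walk-map : ∀ {A : Set} {R S : A → A → Set} {u v xs} →
           (∀ {a b} → a ∈ xs → b ∈ xs → R a b → S a b) → Walk R u xs v → Walk S u xs v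
walk-map f end = end
walk-map f (e ◂ p) = f (here refl) (there (head∈ p)) e ◂ walk-map (λ a b → f (there a) (there b)) p

-- Degrees and cycles on vertex lists

module _ {n : ℕ} (G : Graph n) where

  deg : Fin n → List (Fin n) → ℕ
  deg v = count (adj G v)

  adj? : ∀ u v → Dec (Adj G u v)
  adj? u v = adj G u v Bool.≟ true

  adj-sym : ∀ {u v} → Adj G u v → Adj G v u
  adj-sym {u} {v} e = trans (Graph.sym G v u) e

  adj⇒≢ : ∀ {u v} → Adj G u v → u ≢ v
  adj⇒≢ {u} e refl with trans (sym (irrefl G u)) e
  ... | ()

  -- A path with a closing edge. Two adjacent vertices also qualify when `k` is at most 2, which is
  -- why `longCycle⇒` asks for `3 ≤ k`.
  LongCycle : ℕ → Set
  LongCycle k = ∃ λ xs → ∃₂ λ u v → Walk (Adj G) u xs v × Adj G v u × Unique xs × k ≤ length xs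

  lookup-injective : ∀ {xs : List (Fin n)} → Unique xs → ∀ i j → lookup xs i ≡ lookup xs j → i ≡ j
  lookup-injective {x ∷ xs} u zero zero eq = refl
  lookup-injective {x ∷ xs} u zero (suc j) refl = ⊥-elim (proj₁ (unique-∷⁻ u) (∈-lookup j))
  lookup-injective {x ∷ xs} u (suc i) zero refl = ⊥-elim (proj₁ (unique-∷⁻ u) (∈-lookup i))
  lookup-injective {x ∷ xs} u (suc i) (suc j) eq = cong suc (lookup-injective (proj₂ (unique-∷⁻ u)) i j eq)

  lookup-step : ∀ {u v xs} → Walk (Adj G) u xs v → ∀ i j → toℕ j ≡ suc (toℕ i) →
                Adj G (lookup xs i) (lookup xs j)
  lookup-step end zero zero ()
  lookup-step (e ◂ end) zero (suc zero) eq = e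
  lookup-step (e ◂ (_ ◂ _)) zero (suc zero) eq = e
  lookup-step (e ◂ p) (suc i) (suc j) eq = lookup-step p i j (suc-injective eq)

  lookup-first : ∀ {u v xs} → Walk (Adj G) u xs v → ∀ i → toℕ i ≡ 0 → lookup xs i ≡ u
  lookup-first end zero eq = refl
  lookup-first (e ◂ p) zero eq = refl

  lookup-last : ∀ {u v xs} → Walk (Adj G) u xs v → ∀ i → suc (toℕ i) ≡ length xs → lookup xs i ≡ v
  lookup-last end zero eq = refl
  lookup-last (e ◂ end) zero ()
  lookup-last (e ◂ (_ ◂ _)) zero ()
  lookup-last (e ◂ p) (suc i) eq = lookup-last p i (suc-injective eq)

  longCycle⇒ : ∀ {k} → 3 ≤ k → LongCycle k → ∃ λ ℓ → k ≤ ℓ × HasCycleOfLength G ℓ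
  longCycle⇒ 3≤k (xs , u , v , p , e , uq , k≤) =
    length xs , k≤ , ≤-trans 3≤k k≤ , lookup xs , (λ {i} {j} → lookup-injective uq i j)
    , lookup-step p
    , λ i j i≡0 j≡last → subst₂ (Adj G) (sym (lookup-last p j j≡last)) (sym (lookup-first p i i≡0)) e

  tabulate-walk : ∀ {ℓ} {R : Fin n → Fin n → Set} (c : Fin (suc ℓ) → Fin n) →
                  (∀ i j → toℕ j ≡ suc (toℕ i) → R (c i) (c j)) →
                  ∃ λ j → suc (toℕ j) ≡ suc ℓ × Walk R (c zero) (tabulate c) (c j)
  tabulate-walk {zero} c h = zero , refl , end
  tabulate-walk {suc ℓ} c h with tabulate-walk (c ∘ suc) (λ i j eq → h (suc i) (suc j) (cong suc eq))
  ... | j , eq , p = suc j , cong suc eq , h zero (suc zero) refl ◂ p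

-- Kopylov's lemma

cut : ∀ {A : Set} {R : A → A → Set} {u a v z} xs {ys} → Walk R u (a ∷ xs ++ z ∷ ys) v →
      ∃ λ w → Walk R u (a ∷ xs) w × R w z × Walk R z (z ∷ ys) v
cut [] (e ◂ end) = _ , end , e , end
cut [] (e ◂ (e′ ◂ p)) = _ , end , e , e′ ◂ p
cut (x ∷ xs) (e ◂ p) with cut xs p
... | w , q , e′ , r = w , e ◂ q , e′ , r

indicator : Bool → ℕ
indicator true = 1
indicator false = 0

indicator≤1 : ∀ b → indicator b ≤ 1
indicator≤1 true = s≤s z≤n
indicator≤1 false = z≤n

count-∷ : ∀ {A : Set} (r : A → Bool) x xs → count r (x ∷ xs) ≡ indicator (r x) + count r xs
count-∷ r x xs with r x
... | true = refl
... | false = refl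

module _ {A : Set} (p q : A → Bool) where

  NotBoth : A → A → Set
  NotBoth u w = ¬ (q u ≡ true × p w ≡ true)

  -- Each step from `u` to `w` pays for at most one of `q u` and `p w`; the last vertex is left
  -- without a step of its own. Later `p` and `q` are adjacency to the two ends of a path.
  count-notBoth : ∀ {u v} xs → Walk NotBoth u (u ∷ xs) v →
                  count p xs + count q (u ∷ xs) ≤ length xs + indicator (q v)
  count-notBoth {u} [] end = ≤-reflexive (trans (count-∷ q u []) (+-identityʳ _))
  count-notBoth {u} {v} (w ∷ xs) (h ◂ r) with walk-head r
  ... | _ , refl = begin
      count p (w ∷ xs) + count q (u ∷ w ∷ xs)
        ≡⟨ cong₂ _+_ (count-∷ p w xs) (count-∷ q u (w ∷ xs)) ⟩
      (indicator (p w) + count p xs) + (indicator (q u) + count q (w ∷ xs))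
        ≡⟨ arrange (indicator (p w)) (count p xs) (indicator (q u)) _ ⟩
      (indicator (p w) + indicator (q u)) + (count p xs + count q (w ∷ xs))
        ≤⟨ +-mono-≤ (atMostOne h) (count-notBoth xs r) ⟩
      suc (length xs + indicator (q v)) ∎
    where
    open ≤-Reasoning
    arrange : ∀ a b c d → (a + b) + (c + d) ≡ (a + c) + (b + d)
    arrange = solve-∀
    atMostOne : NotBoth u w → indicator (p w) + indicator (q u) ≤ 1
    atMostOne h with p w | q u
    ... | true | true = ⊥-elim (h (refl , refl))
    ... | true | false = s≤s z≤n
    ... | false | true = s≤s z≤n
    ... | false | false = z≤n

  count-notBoth-head : ∀ {u v xs} → Walk NotBoth u xs v → p u ≡ false → count p xs + count q xs ≤ length xs
  count-notBoth-head {u} {v} {xs} r pu with walk-head r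
  ... | ys , refl = begin
      count p (u ∷ ys) + count q (u ∷ ys)
        ≡⟨ cong (_+ count q (u ∷ ys)) (trans (count-∷ p u ys) (cong (λ b → indicator b + count p ys) pu)) ⟩
      count p ys + count q (u ∷ ys)  ≤⟨ count-notBoth ys r ⟩
      length ys + indicator (q v)    ≤⟨ +-monoʳ-≤ (length ys) (indicator≤1 (q v)) ⟩
      length ys + 1                  ≡⟨ +-comm (length ys) 1 ⟩
      suc (length ys)                ∎
    where open ≤-Reasoning

  count-notBoth-last : ∀ {u v xs} → Walk NotBoth u xs v → q v ≡ false → count p xs + count q xs ≤ length xs
  count-notBoth-last {u} {v} {xs} r qv with walk-head r
  ... | ys , refl = begin
      count p (u ∷ ys) + count q (u ∷ ys)
        ≡⟨ cong (_+ count q (u ∷ ys)) (count-∷ p u ys) ⟩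
      indicator (p u) + count p ys + count q (u ∷ ys)   ≡⟨ +-assoc (indicator (p u)) _ _ ⟩
      indicator (p u) + (count p ys + count q (u ∷ ys))
        ≤⟨ +-mono-≤ (indicator≤1 (p u)) (count-notBoth ys r) ⟩
      suc (length ys + indicator (q v))
        ≡⟨ cong suc (trans (cong (λ b → length ys + indicator b) qv) (+-identityʳ _)) ⟩
      suc (length ys)                ∎
    where open ≤-Reasoning

  notBoth? : ∀ {R : A → A → Set} {u xs v} → Walk R u xs v →
    (∃ λ as → ∃ λ a → ∃₂ λ b bs → xs ≡ as ++ a ∷ b ∷ bs × q a ≡ true × p b ≡ true) ⊎ Walk NotBoth u xs v
  notBoth? end = inj₂ end
  notBoth? (_◂_ {u} {w} e r) with notBoth? r | q u in qu | p w in pw | walk-head r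
  ... | inj₁ (as , a , b , bs , refl , qa , pb) | _ | _ | _ = inj₁ (u ∷ as , a , b , bs , refl , qa , pb)
  ... | inj₂ s | true | true | ys , refl = inj₁ ([] , u , w , ys , refl , qu , pw)
  ... | inj₂ s | true | false | _ = inj₂ ((λ (_ , pw′) → Bool.not-¬ pw pw′) ◂ s)
  ... | inj₂ s | false | _ | _ = inj₂ ((λ (qu′ , _) → Bool.not-¬ qu qu′) ◂ s)

module _ {n : ℕ} (G : Graph n) where

  open DecMembership (Fin._≟_ {n}) using (_∈?_)

  -- If the start recurs on the path already built, everything before the recurrence is dropped.
  -- `WalkAvoiding` does not test its starting vertex, hence the separate `u ≢ w`.
  loopErase : ∀ {w u v} → WalkAvoiding G w u v → u ≢ w →
              ∃ λ xs → Walk (Adj G) u xs v × Unique xs × w ∉ xs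
  loopErase here u≢w = _ , end , [] ∷ [] , λ { (here w≡u) → u≢w (sym w≡u) }
  loopErase {w} {u} (step e x≢w p) u≢w with loopErase p x≢w
  ... | xs , q , uq , w∉ with u ∈? xs
  ... | no u∉ = u ∷ xs , e ◂ q , unique-∷⁺ u∉ uq
      , λ { (here w≡u) → u≢w (sym w≡u) ; (there m) → w∉ m }
  ... | yes u∈ with ∈-∃++ u∈
  ... | as , bs , refl = u ∷ bs , proj₂ (split as q) , proj₁ (proj₂ (unique-++⁻ as uq)) , w∉ ∘ ∈-++⁺ʳ as

  -- On a simple path from `a` to `b` avoiding `w`, take the first vertex τ in `Y` and then the last
  -- vertex `z` in `X` before it. What lies strictly between them, `D`, meets neither set.
  bypass : TwoConnected G → ∀ {w a b} {X Y : List (Fin n)} →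
           a ∈ X → b ∈ Y → a ≢ w → b ≢ w → Disj X Y →
           ∃₂ λ z D → ∃₂ λ δ τ → z ∈ X × z ≢ w × τ ∈ Y × Walk (Adj G) z (z ∷ D) δ × Adj G δ τ
             × Unique D × Disj D X × Disj D Y
  bypass (_ , conn) {w} {a} {b} {X} {Y} a∈ b∈ a≢w b≢w disj
    with loopErase (conn w a b a≢w b≢w) a≢w
  ... | xs , p , uq , w∉ with splitFirst∈ (_∈? Y) (last∈ p) b∈
  bypass _ a∈ b∈ a≢w b≢w disj | _ , p , uq , w∉ | [] , τ , zs , refl , τ∈ , none with walk-head p
  ... | _ , refl = ⊥-elim (disj a∈ τ∈)
  bypass _ {b = b} {X} {Y} a∈ b∈ a≢w b≢w disj | _ , p , uq , w∉ | c ∷ ys , τ , zs , refl , τ∈ , none with walk-head p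
  ... | _ , refl with splitLast∈ (_∈? X) {xs = c ∷ ys} (here refl) a∈
  ... | us , z , D , eq , z∈ , noneX =
      z , D , δ , τ , z∈ , (λ { refl → w∉ (subst (z ∈_) (sym eq′) (∈-++⁺ʳ us (here refl))) })
      , τ∈ , q , e
      , proj₂ (unique-∷⁻ (proj₁ (unique-++⁻ (z ∷ D) (proj₁ (proj₂ (unique-++⁻ us (subst Unique eq′ uq)))))))
      , noneX , λ m → none (subst (_ ∈_) (sym eq) (∈-++⁺ʳ us (there m)))
    where
    eq′ : (c ∷ ys) ++ τ ∷ zs ≡ us ++ z ∷ (D ++ τ ∷ zs)
    eq′ = trans (cong (_++ τ ∷ zs) eq) (++-assoc us (z ∷ D) (τ ∷ zs))
    r = cut D (proj₂ (split us (subst (λ l → Walk (Adj G) c l b) eq′ p)))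
    δ = proj₁ r
    q = proj₁ (proj₂ r)
    e = proj₁ (proj₂ (proj₂ r))

  -- Kopylov's lemma when no neighbour of y precedes a neighbour of x

  module NonCrossing
    {x y v : Fin n} {S₀ R : List (Fin n)} {k : ℕ} (conn : TwoConnected G)
    (path : Walk (Adj G) x (S₀ ++ v ∷ R) y) (uniq : Unique (S₀ ++ v ∷ R))
    (x∈S₀ : x ∈ S₀) (x~v : Adj G x v)
    (x≁R : ∀ {u} → u ∈ R → ¬ Adj G x u) (y≁S₀ : ∀ {u} → u ∈ S₀ → ¬ Adj G y u)
    (degrees : k ≤ deg G x (S₀ ++ v ∷ R) + deg G y (S₀ ++ v ∷ R)) where

    v∉S₀ : v ∉ S₀
    v∉S₀ m = proj₂ (proj₂ (unique-++⁻ S₀ uniq)) m (here refl)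

    -- A path O leaving S₀ at some α and returning at v. It closes to a cycle through x and all its
    -- neighbours: walk back from v to the first neighbour of x after α, jump to x, and go on to α.
    record Ear (O : List (Fin n)) : Set where
      constructor ear
      field
        {α} : Fin n
        α∈S₀ : α ∈ S₀
        walk : Walk (Adj G) α (α ∷ O) v
        unique : Unique O
        avoids : Disj O S₀

    -- Rerouting may lose parts of `O`. Only the detour `Z` must survive whole, since it carries
    -- either the vertex that the ear is to reach next or all neighbours of y.
    record Rerouted (O D Z : List (Fin n)) : Set where
      constructor rerouted
      field
        {O′} : List (Fin n)
        newEar : Ear O′
        Z⊆ : Z ⊆ O′
        ⊆ODZ : ∀ {u} → u ∈ O′ → u ∈ O ⊎ u ∈ D ⊎ u ∈ Z

    module _ {w z δ τ : Fin n} {D Z : List (Fin n)}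
      (Zw : Walk (Adj G) w Z τ) (uZ : Unique Z) (Z∩S₀ : Disj Z S₀)
      (Dw : Walk (Adj G) z (z ∷ D) δ) (δ~τ : Adj G δ τ) (uD : Unique D) (D∩Z : Disj D Z) where

      rerouteHead : ∀ {O α} A {B} → α ∈ S₀ → Walk (Adj G) α (α ∷ A) z → Walk (Adj G) w (w ∷ B) v →
        Unique A → Unique B → Disj A B → A ⊆ O → B ⊆ O → w ∉ A → w ∉ B →
        Disj O S₀ → (∀ {u} → u ∈ O → u ∈ Z → u ≡ w) → Disj D S₀ → Disj D O → Rerouted O D Z
      rerouteHead {O} A {B} α∈ Aw Bw uA uB A∩B A⊆ B⊆ w∉A w∉B O∩S₀ O∩Z D∩S₀ D∩O = rerouted
        (ear α∈ (join (append (join Aw Dw) δ~τ (walk-reverse (adj-sym G) Zw)) Bw)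
          (unique-++⁺ (unique-++⁺ (unique-++⁺ uA uD λ a d → D∩O d (A⊆ a)) (unique-reverse uZ) AD∩Z) uB ADZ∩B)
          λ m s → [ (λ o → O∩S₀ o s) , [ (λ d → D∩S₀ d s) , (λ c → Z∩S₀ c s) ]′ ]′ (back m))
        (∈-++⁺ˡ ∘ ∈-++⁺ʳ (A ++ D) ∘ reverse⁺)
        back
        where
        AD∩Z : Disj (A ++ D) (reverse Z)
        AD∩Z m c with ∈-++⁻ A m
        ... | inj₁ a with O∩Z (A⊆ a) (reverse⁻ c)
        ... | refl = w∉A a
        AD∩Z m c | inj₂ d = D∩Z d (reverse⁻ c)
        ADZ∩B : Disj ((A ++ D) ++ reverse Z) B
        ADZ∩B m b with ∈-++⁻ (A ++ D) m
        ... | inj₂ c with O∩Z (B⊆ b) (reverse⁻ c)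
        ... | refl = w∉B b
        ADZ∩B m b | inj₁ m′ with ∈-++⁻ A m′
        ... | inj₁ a = A∩B a b
        ... | inj₂ d = D∩O d (B⊆ b)
        back : ∀ {u} → u ∈ ((A ++ D) ++ reverse Z) ++ B → u ∈ O ⊎ u ∈ D ⊎ u ∈ Z
        back m with ∈-++⁻ ((A ++ D) ++ reverse Z) m
        ... | inj₂ b = inj₁ (B⊆ b)
        ... | inj₁ m′ with ∈-++⁻ (A ++ D) m′
        ... | inj₂ c = inj₂ (inj₂ (reverse⁻ c))
        ... | inj₁ m″ with ∈-++⁻ A m″
        ... | inj₁ a = inj₁ (A⊆ a)
        ... | inj₂ d = inj₂ (inj₁ d)

      rerouteTail : ∀ {O α γ} A {B} → α ∈ S₀ → Walk (Adj G) α (α ∷ A) γ → Adj G γ w →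
        Walk (Adj G) z (z ∷ B) v → Unique A → Unique (z ∷ B) → Disj A (z ∷ B) → A ⊆ O → z ∷ B ⊆ O →
        w ∉ A → w ∉ z ∷ B →
        Disj O S₀ → (∀ {u} → u ∈ O → u ∈ Z → u ≡ w) → Disj D S₀ → Disj D O → Rerouted O D Z
      rerouteTail {O} A {B} α∈ Aw γ~w Bw uA uB A∩B A⊆ B⊆ w∉A w∉B O∩S₀ O∩Z D∩S₀ D∩O = rerouted
        (ear α∈ (join (append (append Aw γ~w Zw) (adj-sym G δ~τ) (walk-reverse (adj-sym G) Dw)) Bw)
          (unique-++⁺ (unique-++⁺ (unique-++⁺ uA uZ A∩Z)
            (unique-reverse (unique-∷⁺ (λ d → D∩O d (B⊆ (here refl))) uD)) AZ∩D) (proj₂ (unique-∷⁻ uB)) AZD∩B)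
          λ m s → [ (λ o → O∩S₀ o s) , [ (λ d → D∩S₀ d s) , (λ c → Z∩S₀ c s) ]′ ]′ (back m))
        (∈-++⁺ˡ ∘ ∈-++⁺ˡ ∘ ∈-++⁺ʳ A)
        back
        where
        A∩Z : Disj A Z
        A∩Z a c with O∩Z (A⊆ a) c
        ... | refl = w∉A a
        B∩Z : Disj (z ∷ B) Z
        B∩Z b c with O∩Z (B⊆ b) c
        ... | refl = w∉B b
        AZ∩D : Disj (A ++ Z) (reverse (z ∷ D))
        AZ∩D m d with ∈-++⁻ A m | reverse⁻ {xs = z ∷ D} d
        ... | inj₁ a | here refl = A∩B a (here refl)
        ... | inj₁ a | there d′ = D∩O d′ (A⊆ a)
        ... | inj₂ c | here refl = B∩Z (here refl) c
        ... | inj₂ c | there d′ = D∩Z d′ c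
        AZD∩B : Disj ((A ++ Z) ++ reverse (z ∷ D)) B
        AZD∩B m b with ∈-++⁻ (A ++ Z) m
        ... | inj₂ d with reverse⁻ {xs = z ∷ D} d
        ... | here refl = proj₁ (unique-∷⁻ uB) b
        ... | there d′ = D∩O d′ (B⊆ (there b))
        AZD∩B m b | inj₁ m′ with ∈-++⁻ A m′
        ... | inj₁ a = A∩B a (there b)
        ... | inj₂ c = B∩Z (there b) c
        back : ∀ {u} → u ∈ ((A ++ Z) ++ reverse (z ∷ D)) ++ B → u ∈ O ⊎ u ∈ D ⊎ u ∈ Z
        back m with ∈-++⁻ ((A ++ Z) ++ reverse (z ∷ D)) m
        ... | inj₂ b = inj₁ (B⊆ (there b))
        ... | inj₁ m′ with ∈-++⁻ (A ++ Z) m′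
        ... | inj₂ d with reverse⁻ {xs = z ∷ D} d
        ... | here refl = inj₁ (B⊆ (here refl))
        ... | there d′ = inj₂ (inj₁ d′)
        back m | inj₁ m′ | inj₁ m″ with ∈-++⁻ A m″
        ... | inj₁ a = inj₁ (A⊆ a)
        ... | inj₂ c = inj₂ (inj₂ c)

      -- Cut the ear at `w` into `O₁` and `O₂`. If the bypass starts in `S₀` or in `O₁`, follow it
      -- to τ and traverse `Z` backwards to `w`, then continue with `O₂`; a start in `S₀` becomes
      -- the new foot of the ear. If it starts in `O₂`, traverse `Z` forwards from `w` to τ and come
      -- back along the bypass.
      reroute : ∀ {O} → Ear O → w ∈ O → (∀ {u} → u ∈ O → u ∈ Z → u ≡ w) →
        z ∈ S₀ ++ O → z ≢ w → Disj D (S₀ ++ O) → Rerouted O D Z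
      reroute (ear α∈ Ow uO O∩S₀) w∈ O∩Z z∈ z≢w D∩ with ∈-∃++ w∈
      ... | O₁ , O₂ , refl with unique-++⁻ O₁ uO | cut O₁ Ow | ∈-++⁻ S₀ z∈
      ... | u₁ , u₂ , O₁∩O₂ | γ , O₁w , γ~w , O₂w | inj₁ z∈S₀ =
        rerouteHead [] z∈S₀ end O₂w [] (proj₂ (unique-∷⁻ u₂)) (λ ()) (λ ()) (∈-++⁺ʳ O₁ ∘ there)
          (λ ()) (proj₁ (unique-∷⁻ u₂)) O∩S₀ O∩Z (λ d → D∩ d ∘ ∈-++⁺ˡ) (λ d → D∩ d ∘ ∈-++⁺ʳ S₀)
      ... | u₁ , u₂ , O₁∩O₂ | γ , O₁w , γ~w , O₂w | inj₂ z∈O with ∈-++⁻ O₁ z∈O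
      ... | inj₂ (here z≡w) = ⊥-elim (z≢w z≡w)
      ... | inj₁ z∈O₁ with ∈-∃++ z∈O₁
      ... | O₁₁ , O₁₂ , refl =
        rerouteHead (O₁₁ ++ [ z ]) α∈ (proj₁ (split (_ ∷ O₁₁) O₁w)) O₂w
          (proj₁ (unique-++⁻ (O₁₁ ++ [ z ]) (subst Unique (sym (++-assoc O₁₁ [ z ] O₁₂)) u₁)))
          (proj₂ (unique-∷⁻ u₂)) (λ a b → O₁∩O₂ (sub a) (there b)) (∈-++⁺ˡ ∘ sub)
          (∈-++⁺ʳ (O₁₁ ++ z ∷ O₁₂) ∘ there) (λ a → O₁∩O₂ (sub a) (here refl)) (proj₁ (unique-∷⁻ u₂))
          O∩S₀ O∩Z (λ d → D∩ d ∘ ∈-++⁺ˡ) (λ d → D∩ d ∘ ∈-++⁺ʳ S₀)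
        where
        sub : O₁₁ ++ [ z ] ⊆ O₁₁ ++ z ∷ O₁₂
        sub a with ∈-++⁻ O₁₁ a
        ... | inj₁ b = ∈-++⁺ˡ b
        ... | inj₂ (here refl) = ∈-++⁺ʳ O₁₁ (here refl)
      reroute (ear α∈ Ow uO O∩S₀) w∈ O∩Z z∈ z≢w D∩ | O₁ , O₂ , refl
        | u₁ , u₂ , O₁∩O₂ | γ , O₁w , γ~w , O₂w | inj₂ z∈O | inj₂ (there z∈O₂) with ∈-∃++ z∈O₂
      ... | O₂₁ , O₂₂ , refl =
        rerouteTail O₁ α∈ O₁w γ~w (proj₂ (split (_ ∷ O₂₁) O₂w)) u₁
          (proj₁ (proj₂ (unique-++⁻ (_ ∷ O₂₁) u₂))) (λ a b → O₁∩O₂ a (there (∈-++⁺ʳ O₂₁ b)))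
          ∈-++⁺ˡ (∈-++⁺ʳ O₁ ∘ there ∘ ∈-++⁺ʳ O₂₁)
          (λ a → O₁∩O₂ a (here refl)) (proj₁ (unique-∷⁻ u₂) ∘ ∈-++⁺ʳ O₂₁)
          O∩S₀ O∩Z (λ d → D∩ d ∘ ∈-++⁺ˡ) (λ d → D∩ d ∘ ∈-++⁺ʳ S₀)

    close : ∀ {O} → Ear O → (∀ {u} → u ∈ S₀ ++ v ∷ R → Adj G y u → u ∈ O) → LongCycle G k
    close (ear α∈ end uO O∩S₀) _ = ⊥-elim (v∉S₀ α∈)
    close {O} (ear {α} α∈ (α~β ◂ Ow) uO O∩S₀) y-nbrs with ∈-∃++ α∈
    ... | Sa , Sb , refl = O ++ W , _ , α , join Ow Ww , α~β , uOW , long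
      where
      S = Sa ++ α ∷ Sb
      toV : Walk (Adj G) x (Sa ++ α ∷ (Sb ++ [ v ])) v
      toV = subst (λ l → Walk (Adj G) x l v) (++-assoc Sa (α ∷ Sb) [ v ]) (proj₁ (split S path))
      uS : Unique (Sa ++ α ∷ (Sb ++ [ v ]))
      uS = subst Unique (++-assoc Sa (α ∷ Sb) [ v ])
        (unique-++⁺ (proj₁ (unique-++⁻ S uniq)) ([] ∷ []) λ { m (here refl) → v∉S₀ m })
      firstNbr = splitFirst∈ (adj? G x) {xs = Sb ++ [ v ]} (∈-++⁺ʳ Sb (here refl)) x~v
      g = proj₁ firstNbr
      c = proj₁ (proj₂ firstNbr)
      h = proj₁ (proj₂ (proj₂ firstNbr))
      eq : Sb ++ [ v ] ≡ g ++ c ∷ h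
      eq = proj₁ (proj₂ (proj₂ (proj₂ firstNbr)))
      x~c : Adj G x c
      x~c = proj₁ (proj₂ (proj₂ (proj₂ (proj₂ firstNbr))))
      x≁g : None (adj? G x) g
      x≁g = proj₂ (proj₂ (proj₂ (proj₂ (proj₂ firstNbr))))
      uS′ : Unique ((Sa ++ [ α ]) ++ (g ++ c ∷ h))
      uS′ = subst Unique (trans (cong (λ l → Sa ++ α ∷ l) eq) (sym (++-assoc Sa [ α ] (g ++ c ∷ h)))) uS
      fromC : Walk (Adj G) c (c ∷ h) v
      fromC = proj₂ (proj₂ (proj₂ (cut g
        (subst (λ l → Walk (Adj G) α (α ∷ l) v) eq (proj₂ (split Sa toV))))))
      L = reverse (c ∷ h) ++ (Sa ++ [ α ])
      Lw : Walk (Adj G) v L α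
      Lw = append (walk-reverse (adj-sym G) fromC) (adj-sym G x~c) (proj₁ (split Sa toV))
      uL : Unique L
      uL with unique-++⁻ (Sa ++ [ α ]) uS′
      ... | u₁ , u₂ , d = unique-++⁺ (unique-reverse (proj₁ (proj₂ (unique-++⁻ g u₂)))) u₁
        λ a b → d b (∈-++⁺ʳ g (reverse⁻ a))
      W = proj₁ (walk-head Lw)
      L≡ : L ≡ v ∷ W
      L≡ = proj₂ (walk-head Lw)
      Ww : Walk (Adj G) v (v ∷ W) α
      Ww = subst (λ l → Walk (Adj G) v l α) L≡ Lw
      uW : v ∉ W × Unique W
      uW = unique-∷⁻ (subst Unique L≡ uL)
      inSv : ∀ {u} → u ∈ L → u ∈ S ⊎ u ≡ v
      inSv m with ∈-++⁻ (reverse (c ∷ h)) m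
      ... | inj₂ b with ∈-++⁻ Sa b
      ... | inj₁ b′ = inj₁ (∈-++⁺ˡ b′)
      ... | inj₂ (here refl) = inj₁ (∈-++⁺ʳ Sa (here refl))
      inSv m | inj₁ a with ∈-++⁻ Sb (subst (_ ∈_) (sym eq) (∈-++⁺ʳ g (reverse⁻ {xs = c ∷ h} a)))
      ... | inj₁ b = inj₁ (∈-++⁺ʳ Sa (there b))
      ... | inj₂ (here refl) = inj₂ refl
      uOW : Unique (O ++ W)
      uOW = unique-++⁺ uO (proj₂ uW) λ o m → [ O∩S₀ o , (λ { refl → proj₁ uW m }) ]′
        (inSv (subst (_ ∈_) (sym L≡) (there m)))
      inW : ∀ {u} → u ∈ S → u ∈ L → u ∈ W
      inW s m with subst (_ ∈_) L≡ m
      ... | here refl = ⊥-elim (v∉S₀ s)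
      ... | there m′ = m′
      x∈L : x ∈ L
      x∈L = ∈-++⁺ʳ (reverse (c ∷ h)) (head∈ (proj₁ (split Sa toV)))
      nbr∈L : ∀ {u} → u ∈ S → Adj G x u → u ∈ L
      nbr∈L s e with ∈-++⁻ Sa s
      ... | inj₁ a = ∈-++⁺ʳ (reverse (c ∷ h)) (∈-++⁺ˡ a)
      ... | inj₂ (here refl) = ∈-++⁺ʳ (reverse (c ∷ h)) (∈-++⁺ʳ Sa (here refl))
      ... | inj₂ (there b) with ∈-++⁻ g (subst (_ ∈_) eq (∈-++⁺ˡ {ys = [ v ]} b))
      ... | inj₁ b′ = ⊥-elim (x≁g b′ e)
      ... | inj₂ b′ = ∈-++⁺ˡ (reverse⁺ b′)
      P = S ++ v ∷ R
      X = filterᵇ (adj G x) S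
      Y = filterᵇ (adj G y) P
      y≁x : ¬ Adj G y x
      y≁x = y≁S₀ x∈S₀
      -- The neighbour `v` of x may also be a neighbour of y, so it cannot be counted twice; x
      -- itself takes its place. This gives 1 + (deg x - 1) + deg y vertices, with nothing to spare.
      uT : Unique (x ∷ X ++ Y)
      uT = unique-∷⁺
        (λ m → [ (λ a → adj⇒≢ G (proj₂ (∈-filterᵇ⁻ (adj G x) S a)) refl)
               , (λ b → y≁x (proj₂ (∈-filterᵇ⁻ (adj G y) P b))) ]′ (∈-++⁻ X m))
        (unique-++⁺ (unique-filterᵇ _ (proj₁ (unique-++⁻ S uniq))) (unique-filterᵇ _ uniq)
          λ a b → y≁S₀ (proj₁ (∈-filterᵇ⁻ (adj G x) S a)) (proj₂ (∈-filterᵇ⁻ (adj G y) P b)))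
      T⊆ : x ∷ X ++ Y ⊆ O ++ W
      T⊆ (here refl) = ∈-++⁺ʳ O (inW x∈S₀ x∈L)
      T⊆ (there m) with ∈-++⁻ X m
      ... | inj₁ a = let s , e = ∈-filterᵇ⁻ (adj G x) S a in ∈-++⁺ʳ O (inW s (nbr∈L s e))
      ... | inj₂ b = let s , e = ∈-filterᵇ⁻ (adj G y) P b in ∈-++⁺ˡ (y-nbrs s e)
      degX : deg G x P ≡ suc (length X)
      degX = begin
        deg G x P                               ≡⟨ count-++ _ S (v ∷ R) ⟩
        length X + deg G x (v ∷ R)              ≡⟨ cong (length X +_) (count-∷ (adj G x) v R) ⟩
        length X + (indicator (adj G x v) + deg G x R)
          ≡⟨ cong₂ (λ b r → length X + (indicator b + r)) x~v (count-none (adj G x) x≁R) ⟩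
        length X + 1                            ≡⟨ +-comm (length X) 1 ⟩
        suc (length X)                          ∎
        where open ≡-Reasoning
      long : k ≤ length (O ++ W)
      long = begin
        k                              ≤⟨ degrees ⟩
        deg G x P + length Y           ≡⟨ cong (_+ length Y) degX ⟩
        suc (length X) + length Y      ≡⟨ cong suc (sym (length-++ X)) ⟩
        length (x ∷ X ++ Y)            ≤⟨ length-⊆ uT T⊆ ⟩
        length (O ++ W)                ∎
        where open ≤-Reasoning

    -- The ear currently reaches the path at w and misses Tail, the part of the path behind w. A bypass of
    -- w reroutes the ear to a vertex τ of Tail; once a neighbour of y lies before τ, the detour from w
    -- to τ can be led through all neighbours of y instead of along the path.
    record State (Tail : List (Fin n)) : Set where
      constructor state
      field
        {Pre} : List (Fin n)
        {w} : Fin n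
        {O} : List (Fin n)
        path≡ : S₀ ++ v ∷ R ≡ Pre ++ w ∷ Tail
        y≁Pre : ∀ {u} → u ∈ Pre → ¬ Adj G y u
        S₀∩T : Disj S₀ Tail
        e : Ear O
        w∈O : w ∈ O
        O∩T : Disj O Tail

    module Step {Tail} (s : State Tail) where
      open State s

      path′ : Walk (Adj G) x (Pre ++ w ∷ Tail) y
      path′ = subst (λ l → Walk (Adj G) x l y) path≡ path
      wTw : Walk (Adj G) w (w ∷ Tail) y
      wTw = proj₂ (split Pre path′)
      uwT : Unique (w ∷ Tail)
      uwT = proj₁ (proj₂ (unique-++⁻ Pre (subst Unique path≡ uniq)))
      x≢w : x ≢ w
      x≢w refl = Ear.avoids e w∈O x∈S₀

      -- Otherwise `w` is y, and its predecessor on the path would be a neighbour of y in `Pre`.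
      -- With `Pre` empty, `w` would be x, which the ear avoids.
      tail≢[] : Tail ≢ []
      tail≢[] refl with lastEdge Pre path′
      ... | refl , inj₁ refl = x≢w refl
      ... | refl , inj₂ (u , u∈ , u~y) = y≁Pre u∈ (adj-sym G u~y)

      y∈T : ∀ {T} → Walk (Adj G) w (w ∷ T) y → T ≢ [] → y ∈ T
      y∈T end ≢[] = ⊥-elim (≢[] refl)
      y∈T (_ ◂ q) _ = last∈ q

      module _ {z D δ M τ T′}
        (z∈ : z ∈ S₀ ++ O) (z≢w : z ≢ w) (T≡ : Tail ≡ M ++ τ ∷ T′)
        (Dw : Walk (Adj G) z (z ∷ D) δ) (δ~τ : Adj G δ τ) (uD : Unique D)
        (D∩X : Disj D (S₀ ++ O)) (D∩T : Disj D Tail) where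

        uwMT : Unique ((w ∷ M) ++ τ ∷ T′)
        uwMT = subst (λ l → Unique (w ∷ l)) T≡ uwT
        wMTw : Walk (Adj G) w ((w ∷ M) ++ τ ∷ T′) y
        wMTw = subst (λ l → Walk (Adj G) w (w ∷ l) y) T≡ wTw
        ⊆wT : ∀ {u} → u ∈ (w ∷ M) ++ τ ∷ T′ → u ≡ w ⊎ u ∈ Tail
        ⊆wT (here refl) = inj₁ refl
        ⊆wT (there m) = inj₂ (subst (_ ∈_) (sym T≡) m)
        T′⊆T : T′ ⊆ Tail
        T′⊆T m = subst (_ ∈_) (sym T≡) (∈-++⁺ʳ M (there m))
        wM∩τT′ : Disj (w ∷ M) (τ ∷ T′)
        wM∩τT′ = proj₂ (proj₂ (unique-++⁻ (w ∷ M) uwMT))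
        uτT′ : Unique (τ ∷ T′)
        uτT′ = proj₁ (proj₂ (unique-++⁻ (w ∷ M) uwMT))

        rerouteAlong : ∀ {Z} → Walk (Adj G) w Z τ → Unique Z → Z ⊆ (w ∷ M) ++ τ ∷ T′ → Rerouted O D Z
        rerouteAlong {Z} Zw uZ Z⊆ = reroute Zw uZ
          (λ c s → [ (λ { refl → Ear.avoids e w∈O s }) , S₀∩T s ]′ (⊆wT (Z⊆ c)))
          Dw δ~τ uD
          (λ d c → [ (λ { refl → D∩X d (∈-++⁺ʳ S₀ w∈O) }) , D∩T d ]′ (⊆wT (Z⊆ c)))
          e w∈O (λ o c → [ (λ u≡w → u≡w) , (λ t → ⊥-elim (O∩T o t)) ]′ (⊆wT (Z⊆ c)))
          z∈ z≢w D∩X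

        -- Here the detour is the path itself from `w` to τ. As it passes no neighbour of y before
        -- τ, the whole stretch can join `Pre`.
        next : (∀ {u} → u ∈ w ∷ M → ¬ Adj G y u) → State T′
        next y≁wM = state eq′ y≁Pre′ (λ s → S₀∩T s ∘ T′⊆T) newEar (Z⊆ (∈-++⁺ʳ (w ∷ M) (here refl))) O′∩T′
          where
          Z = (w ∷ M) ++ [ τ ]
          Z⊆P : Z ⊆ (w ∷ M) ++ τ ∷ T′
          Z⊆P m with ∈-++⁻ (w ∷ M) m
          ... | inj₁ a = ∈-++⁺ˡ a
          ... | inj₂ (here refl) = ∈-++⁺ʳ (w ∷ M) (here refl)
          assoc : (w ∷ M) ++ τ ∷ T′ ≡ Z ++ T′
          assoc = sym (++-assoc (w ∷ M) [ τ ] T′)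
          uZT′ = unique-++⁻ Z (subst Unique assoc uwMT)
          open Rerouted (rerouteAlong {Z} (proj₁ (split (w ∷ M) wMTw)) (proj₁ uZT′) Z⊆P)
          eq′ : S₀ ++ v ∷ R ≡ (Pre ++ w ∷ M) ++ τ ∷ T′
          eq′ = trans path≡ (trans (cong (λ l → Pre ++ w ∷ l) T≡) (sym (++-assoc Pre (w ∷ M) (τ ∷ T′))))
          y≁Pre′ : ∀ {u} → u ∈ Pre ++ w ∷ M → ¬ Adj G y u
          y≁Pre′ m = [ y≁Pre , y≁wM ]′ (∈-++⁻ Pre m)
          O′∩T′ : Disj O′ T′
          O′∩T′ o t = [ (λ a → O∩T a (T′⊆T t)) , [ (λ d → D∩T d (T′⊆T t)) , (λ c → proj₂ (proj₂ uZT′) c t) ]′ ]′ (⊆ODZ o)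
        -- The detour follows the path to `d`, jumps to y and runs back along the path to τ. It
        -- skips only `M₂`, and `d` is the last neighbour of y before τ, so every neighbour of y
        -- ends up on the ear.
        finish : ∀ {M₁ d M₂} → w ∷ M ≡ M₁ ++ d ∷ M₂ → Adj G y d → (∀ {u} → u ∈ M₂ → ¬ Adj G y u) → LongCycle G k
        finish {M₁} {d} {M₂} wM≡ y~d y≁M₂ = close newEar y-nbrs
          where
          Z = (M₁ ++ [ d ]) ++ reverse (τ ∷ T′)
          M₁d⊆ : M₁ ++ [ d ] ⊆ w ∷ M
          M₁d⊆ m with ∈-++⁻ M₁ m
          ... | inj₁ a = subst (_ ∈_) (sym wM≡) (∈-++⁺ˡ a)
          ... | inj₂ (here refl) = subst (_ ∈_) (sym wM≡) (∈-++⁺ʳ M₁ (here refl))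
          wM₁w : Walk (Adj G) w (M₁ ++ [ d ]) d
          wM₁w = proj₁ (split M₁ (subst (λ l → Walk (Adj G) w l y)
            (trans (cong (_++ τ ∷ T′) wM≡) (++-assoc M₁ (d ∷ M₂) (τ ∷ T′))) wMTw))
          τw : Walk (Adj G) τ (τ ∷ T′) y
          τw = proj₂ (split (w ∷ M) wMTw)
          uM₁ : Unique (M₁ ++ [ d ])
          uM₁ = proj₁ (unique-++⁻ (M₁ ++ [ d ]) (subst Unique
            (trans wM≡ (sym (++-assoc M₁ [ d ] M₂))) (proj₁ (unique-++⁻ (w ∷ M) uwMT))))
          Z⊆P : Z ⊆ (w ∷ M) ++ τ ∷ T′
          Z⊆P m with ∈-++⁻ (M₁ ++ [ d ]) m
          ... | inj₁ a = ∈-++⁺ˡ (M₁d⊆ a)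
          ... | inj₂ b = ∈-++⁺ʳ (w ∷ M) (reverse⁻ {xs = τ ∷ T′} b)
          Zw : Walk (Adj G) w Z τ
          Zw = append wM₁w (adj-sym G y~d) (walk-reverse (adj-sym G) τw)
          uZ : Unique Z
          uZ = unique-++⁺ uM₁ (unique-reverse uτT′) λ a b → wM∩τT′ (M₁d⊆ a) (reverse⁻ {xs = τ ∷ T′} b)
          open Rerouted (rerouteAlong Zw uZ Z⊆P)
          y-nbrs : ∀ {u} → u ∈ S₀ ++ v ∷ R → Adj G y u → u ∈ O′
          y-nbrs m y~u with ∈-++⁻ Pre (subst (_ ∈_) path≡ m)
          ... | inj₁ a = ⊥-elim (y≁Pre a y~u)
          ... | inj₂ b with ∈-++⁻ (w ∷ M) (subst (λ l → _ ∈ w ∷ l) T≡ b)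
          ... | inj₂ c = Z⊆ (∈-++⁺ʳ (M₁ ++ [ d ]) (reverse⁺ c))
          ... | inj₁ c with ∈-++⁻ M₁ (subst (_ ∈_) wM≡ c)
          ... | inj₁ c₁ = Z⊆ (∈-++⁺ˡ (∈-++⁺ˡ c₁))
          ... | inj₂ (here refl) = Z⊆ (∈-++⁺ˡ (∈-++⁺ʳ M₁ (here refl)))
          ... | inj₂ (there c₂) = ⊥-elim (y≁M₂ c₂ y~u)

      step′ : LongCycle G k ⊎ ∃ λ T′ → length T′ < length Tail × State T′
      step′ with bypass conn {X = S₀ ++ O} {Y = Tail} (∈-++⁺ˡ x∈S₀) y∈ x≢w
          (λ { refl → proj₁ (unique-∷⁻ uwT) y∈ })
          (λ m τ → [ (λ s → S₀∩T s τ) , (λ o → O∩T o τ) ]′ (∈-++⁻ S₀ m))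
        where y∈ = y∈T wTw tail≢[]
      ... | z , D , δ , τ , z∈ , z≢w , τ∈ , Dw , δ~τ , uD , D∩X , D∩T with ∈-∃++ τ∈
      ... | M , T′ , T≡ with splitLast (adj? G y) (w ∷ M)
      ... | inj₁ (M₁ , d , M₂ , wM≡ , y~d , y≁M₂) =
        inj₁ (finish z∈ z≢w T≡ Dw δ~τ uD D∩X D∩T wM≡ y~d y≁M₂)
      ... | inj₂ y≁wM = inj₂ (T′ , shorter , next z∈ z≢w T≡ Dw δ~τ uD D∩X D∩T y≁wM)
        where
        open ≤-Reasoning
        shorter : length T′ < length Tail
        shorter = begin
          suc (length T′)              ≤⟨ m≤n+m _ (length M) ⟩
          length M + suc (length T′)   ≡⟨ sym (length-++ M) ⟩
          length (M ++ τ ∷ T′)         ≡⟨ cong length (sym T≡) ⟩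
          length Tail                  ∎

    advance : ∀ fuel {Tail} → length Tail < fuel → State Tail → LongCycle G k
    advance (suc fuel) (s≤s len) s with Step.step′ s
    ... | inj₁ c = c
    ... | inj₂ (T′ , shorter , s′) = advance fuel (≤-trans shorter len) s′

    longCycle : LongCycle G k
    longCycle with lastEdge S₀ (proj₁ (split S₀ path))
    ... | _ , inj₁ refl = ⊥-elim (v∉S₀ x∈S₀)
    -- The initial ear is the single path edge entering `v`, reached vertex `v`, with tail `R`.
    ... | _ , inj₂ (u , u∈ , u~v) = advance _ ≤-refl (state refl y≁S₀
      (λ s r → proj₂ (proj₂ (unique-++⁻ S₀ uniq)) s (there r))
      (ear u∈ (u~v ◂ end) ([] ∷ []) λ { (here refl) → v∉S₀ })
      (here refl)
      (λ { (here refl) r → proj₁ (unique-∷⁻ (proj₁ (proj₂ (unique-++⁻ S₀ uniq)))) r }))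

  -- Crossing neighbourhoods, and the lemma assembled

  module _ {x y : Fin n} {k : ℕ} where

    -- From x along `pre` to `a`, over to y, back along `post` to `b`, and home to x: only `gap` is
    -- lost.
    crossingCycle : ∀ pre gap post {a b} → Walk (Adj G) x pre a → Walk (Adj G) b post y →
      Adj G y a → Adj G x b → Unique (pre ++ gap ++ post) → k ≤ length pre + length post → LongCycle G k
    crossingCycle pre gap post p q y~a x~b uniq k≤ with unique-++⁻ pre uniq
    ... | u₁ , u₂ , d with unique-++⁻ gap u₂
    ... | _ , u₃ , _ = pre ++ reverse post , x , _
      , append p (adj-sym G y~a) (walk-reverse (adj-sym G) q) , adj-sym G x~b
      , unique-++⁺ u₁ (unique-reverse u₃) (λ a b → d a (∈-++⁺ʳ gap (reverse⁻ b)))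
      , ≤-trans k≤ (≤-reflexive (sym (trans (length-++ pre) (cong (length pre +_) (length-reverse post)))))

    -- The gap contributes to neither degree. On `pre` and on `post` the two degrees together are at
    -- most the number of vertices: the unpaired last vertex of `count-notBoth` is offset on `pre`
    -- by its head x, no neighbour of x, and does not count on `post`, where it is y itself.
    gappedCrossing : ∀ pre gap post {a b} → Walk (Adj G) x pre a → Walk (Adj G) b post y →
      Walk (NotBoth (adj G x) (adj G y)) x pre a → Walk (NotBoth (adj G x) (adj G y)) b post y →
      Adj G y a → Adj G x b → Unique (pre ++ gap ++ post) →
      (∀ {u} → u ∈ gap → ¬ Adj G x u) → (∀ {u} → u ∈ gap → ¬ Adj G y u) →
      k ≤ deg G x (pre ++ gap ++ post) + deg G y (pre ++ gap ++ post) → LongCycle G k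
    gappedCrossing pre gap post p q p′ q′ y~a x~b uniq x≁ y≁ k≤ = crossingCycle pre gap post p q y~a x~b uniq
      (begin
        k ≤⟨ k≤ ⟩
        deg G x (pre ++ gap ++ post) + deg G y (pre ++ gap ++ post)
          ≡⟨ cong₂ _+_ (drop-gap x x≁) (drop-gap y y≁) ⟩
        (deg G x pre + deg G x post) + (deg G y pre + deg G y post)
          ≡⟨ arrange (deg G x pre) _ _ _ ⟩
        (deg G x pre + deg G y pre) + (deg G x post + deg G y post)
          ≤⟨ +-mono-≤ (count-notBoth-head _ _ p′ (irrefl G x)) (count-notBoth-last _ _ q′ (irrefl G y)) ⟩
        length pre + length post ∎)
      where
      open ≤-Reasoning
      arrange : ∀ a b c d → (a + b) + (c + d) ≡ (a + c) + (b + d)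
      arrange = solve-∀
      drop-gap : ∀ w → (∀ {u} → u ∈ gap → ¬ Adj G w u) → deg G w (pre ++ gap ++ post) ≡ deg G w pre + deg G w post
      drop-gap w w≁ = trans (count-++ (adj G w) pre (gap ++ post)) (cong (deg G w pre +_)
        (trans (count-++ (adj G w) gap post) (cong (_+ deg G w post) (count-none (adj G w) w≁))))

    kopylov : TwoConnected G → ∀ {P} → Walk (Adj G) x P y → Unique P → x ≢ y →
      k ≤ length P → k ≤ deg G x P + deg G y P → LongCycle G k
    kopylov conn {P} path uniq x≢y k≤P k≤deg with notBoth? (adj G x) (adj G y) path
    -- With `a` and `b` consecutive there is no gap, so the cycle uses the whole path and its length
    -- suffices without any degree count.
    ... | inj₁ (as , a , b , bs , refl , y~a , x~b) =
      crossingCycle (as ++ [ a ]) [] (b ∷ bs) (proj₁ cuts) (proj₂ (proj₂ cuts)) y~a x~b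
        (subst Unique assoc uniq)
        (≤-trans k≤P (≤-reflexive (trans (cong length assoc) (length-++ (as ++ [ a ])))))
      where
      cuts = splitEdge as path
      assoc : as ++ a ∷ b ∷ bs ≡ (as ++ [ a ]) ++ b ∷ bs
      assoc = sym (++-assoc as [ a ] (b ∷ bs))
    kopylov conn {P} path uniq x≢y k≤P k≤deg | inj₂ path′ = byLastNbr (lastNbr path)
      where
      lastNbr : Walk (Adj G) x P y → _
      lastNbr end = ⊥-elim (x≢y refl)
      lastNbr (e ◂ p) = splitLast∈ (adj? G x) (there (head∈ p)) e

      byLastNbr : (∃ λ S₀ → ∃₂ λ v R → P ≡ S₀ ++ v ∷ R × Adj G x v × None (adj? G x) R) → LongCycle G k
      byLastNbr (S₀ , v , R , refl , x~v , x≁R) with splitLast (adj? G y) S₀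
      ... | inj₂ y≁S₀ = NonCrossing.longCycle conn path uniq (x∈ S₀ path) x~v x≁R y≁S₀ k≤deg
        where
        x∈ : ∀ S₀ → Walk (Adj G) x (S₀ ++ v ∷ R) y → x ∈ S₀
        x∈ [] p with walk-head p
        ... | _ , refl = ⊥-elim (adj⇒≢ G x~v refl)
        x∈ (_ ∷ _) p with walk-head p
        ... | _ , refl = here refl
      -- Taking the last neighbour of y before `v` and then the next neighbour of x, at the latest
      -- `v`, leaves a gap free of neighbours of both.
      ... | inj₁ (S₁ , a , S₂ , refl , y~a , y≁S₂) = crossing (firstNbr (splitFirst (adj? G x) S₂))
        where
        Gap = ∃ λ gap → ∃₂ λ c post → S₂ ++ v ∷ R ≡ gap ++ c ∷ post × Adj G x c
          × None (adj? G x) gap × None (adj? G y) gap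
        firstNbr : _ → Gap
        firstNbr (inj₁ (g , c , h , eq , x~c , x≁g)) = g , c , h ++ v ∷ R
          , trans (cong (_++ v ∷ R) eq) (++-assoc g (c ∷ h) (v ∷ R)) , x~c , x≁g
          , λ m → y≁S₂ (subst (_ ∈_) (sym eq) (∈-++⁺ˡ m))
        firstNbr (inj₂ x≁S₂) = S₂ , v , R , refl , x~v , x≁S₂ , y≁S₂
        crossing : Gap → LongCycle G k
        crossing (gap , c , post , eq , x~c , x≁gap , y≁gap) =
          gappedCrossing (S₁ ++ [ a ]) gap (c ∷ post) (pre path) (suf path) (pre path′) (suf path′) y~a x~c
            (subst Unique P≡ uniq) x≁gap y≁gap (subst (λ l → k ≤ deg G x l + deg G y l) P≡ k≤deg)
          where
          P≡′ : (S₁ ++ a ∷ S₂) ++ v ∷ R ≡ S₁ ++ a ∷ (gap ++ c ∷ post)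
          P≡′ = trans (++-assoc S₁ (a ∷ S₂) (v ∷ R)) (cong (λ l → S₁ ++ a ∷ l) eq)
          P≡ : (S₁ ++ a ∷ S₂) ++ v ∷ R ≡ (S₁ ++ [ a ]) ++ (gap ++ c ∷ post)
          P≡ = trans P≡′ (sym (++-assoc S₁ [ a ] (gap ++ c ∷ post)))
          pre : ∀ {Q} → Walk Q x ((S₁ ++ a ∷ S₂) ++ v ∷ R) y → Walk Q x (S₁ ++ [ a ]) a
          pre p = proj₁ (split S₁ (subst (λ l → Walk _ x l y) P≡′ p))
          suf : ∀ {Q} → Walk Q x ((S₁ ++ a ∷ S₂) ++ v ∷ R) y → Walk Q c (c ∷ post) y
          suf p = proj₂ (split (a ∷ gap) (proj₂ (split S₁ (subst (λ l → Walk _ x l y) P≡′ p))))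

-- Binomial coefficients and clique counts

C-zero : ∀ n → n C 0 ≡ 1
C-zero n = trans (nCk≡nC[n∸k] {0} {n} z≤n) (nCn≡1 n)

C-monoˡ : ∀ k {m n} → m ≤ n → m C k ≤ n C k
C-monoˡ zero {m} {n} _ = ≤-reflexive (trans (C-zero m) (sym (C-zero n)))
C-monoˡ (suc k) {n = n} z≤n = ≤-trans (≤-reflexive (k>n⇒nCk≡0 {0} {suc k} (s≤s z≤n))) z≤n
C-monoˡ (suc k) {suc m} {suc n} (s≤s m≤n) = subst₂ _≤_ (nCk+nC[k+1]≡[n+1]C[k+1] m k)
  (nCk+nC[k+1]≡[n+1]C[k+1] n k) (+-mono-≤ (C-monoˡ k m≤n) (C-monoˡ (suc k) m≤n))

-- A sequence that never falls after a rise first descends and then ascends, so an interval has its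
-- maximum at an end. This form of convexity needs no differences of natural numbers.
quasiconvex : ∀ (g : ℕ → ℕ) → (∀ a → g a ≤ g (suc a) → g (suc a) ≤ g (suc (suc a))) →
              ∀ {l a h} → l ≤ a → a ≤ h → g a ≤ g l ⊔ g h
quasiconvex g keep {l} {a} {h} l≤a a≤h with g a ≤? g (suc a)
... | yes up = ≤-trans (rise up (≤⇒≤′ a≤h)) (m≤n⊔m (g l) (g h))
  where
  steps : ∀ {b c} → g b ≤ g (suc b) → b ≤′ c → g c ≤ g (suc c)
  steps up ≤′-refl = up
  steps up (≤′-step p) = keep _ (steps up p)
  rise : ∀ {b c} → g b ≤ g (suc b) → b ≤′ c → g b ≤ g c
  rise up ≤′-refl = ≤-refl
  rise up (≤′-step p) = ≤-trans (rise up p) (steps up p)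
... | no down = ≤-trans (fall a down l≤a) (m≤m⊔n (g l) (g h))
  where
  fall : ∀ b → ¬ g b ≤ g (suc b) → ∀ {l} → l ≤ b → g b ≤ g l
  fall zero down z≤n = ≤-refl
  fall (suc b) down {l} l≤b with m≤n⇒m<n∨m≡n l≤b
  ... | inj₂ refl = ≤-refl
  ... | inj₁ (s≤s l≤b′) with g b ≤? g (suc b)
  ... | yes up = ⊥-elim (down (keep b up))
  ... | no down′ = ≤-trans (<⇒≤ (≰⇒> down′)) (fall b down′ l≤b′)

-- Increments of f in a: the first summand loses (k − a − 1) C (s − 1), which decreases with a, and
-- the second gains an amount that increases with a.
f-quasiconvex : ∀ r n k {l a h} → l ≤ a → a ≤ h →
                f (suc (suc r)) n k a ≤ f (suc (suc r)) n k l ⊔ f (suc (suc r)) n k h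
f-quasiconvex r n k = quasiconvex (f (suc (suc r)) n k) keep
  where
  m = n ∸ k
  loss gain : ℕ → ℕ
  loss a = (k ∸ suc a) C suc r
  gain a = suc a C suc r + (m + a) * (a C r)

  loss-eq : ∀ a → (k ∸ a) C suc (suc r) ≡ loss a + (k ∸ suc a) C suc (suc r)
  loss-eq a with a <? k
  ... | yes a<k = trans (cong (_C suc (suc r)) (sym (suc-pred-∸ a<k)))
                        (sym (nCk+nC[k+1]≡[n+1]C[k+1] (k ∸ suc a) (suc r)))
    where
    suc-pred-∸ : ∀ {a k} → a < k → suc (k ∸ suc a) ≡ k ∸ a
    suc-pred-∸ {zero} (s≤s _) = refl
    suc-pred-∸ {suc a} (s≤s p) = suc-pred-∸ p
  -- Beyond `k` Pascal's rule does not apply, but truncated subtraction makes every term zero.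
  ... | no a≮k rewrite m≤n⇒m∸n≡0 (≮⇒≥ a≮k) | m≤n⇒m∸n≡0 (m≤n⇒m≤1+n (≮⇒≥ a≮k)) =
    trans (k>n⇒nCk≡0 {0} {suc (suc r)} (s≤s z≤n))
      (sym (cong₂ _+_ (k>n⇒nCk≡0 {0} {suc r} (s≤s z≤n)) (k>n⇒nCk≡0 {0} {suc (suc r)} (s≤s z≤n))))

  gain-eq : ∀ a → (m + suc a) * (suc a C suc r) ≡ gain a + (m + a) * (a C suc r)
  gain-eq a = begin
    (m + suc a) * (suc a C suc r)                              ≡⟨ expand m a (suc a C suc r) ⟩
    suc a C suc r + (m + a) * (suc a C suc r)
      ≡⟨ cong (λ c → suc a C suc r + (m + a) * c) (sym (nCk+nC[k+1]≡[n+1]C[k+1] a r)) ⟩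
    suc a C suc r + (m + a) * (a C r + a C suc r)              ≡⟨ expand′ (suc a C suc r) (m + a) (a C r) _ ⟩
    gain a + (m + a) * (a C suc r)                             ∎
    where
    open ≡-Reasoning
    expand : ∀ m a c → (m + suc a) * c ≡ c + (m + a) * c
    expand = solve-∀
    expand′ : ∀ e b c d → e + b * (c + d) ≡ (e + b * c) + b * d
    expand′ = solve-∀

  loss-anti : ∀ a → loss (suc a) ≤ loss a
  loss-anti a = C-monoˡ (suc r) (∸-monoʳ-≤ k (n≤1+n (suc a)))

  gain-mono : ∀ a → gain a ≤ gain (suc a)
  gain-mono a = +-mono-≤ (C-monoˡ (suc r) (n≤1+n (suc a)))
    (*-mono-≤ (+-monoʳ-≤ m (n≤1+n a)) (C-monoˡ r (n≤1+n a)))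

  -- The common part of the values of `f` at `a` and `suc a`; cancelling it turns their comparison
  -- into `loss a ≤ gain a`.
  balance : ℕ → ℕ
  balance a = (k ∸ suc a) C suc (suc r) + (m + a) * (a C suc r)

  f≡ : ∀ a → f (suc (suc r)) n k a ≡ loss a + balance a
  f≡ a = trans (cong (_+ (m + a) * (a C suc r)) (loss-eq a)) (+-assoc (loss a) _ _)

  f-suc≡ : ∀ a → f (suc (suc r)) n k (suc a) ≡ gain a + balance a
  f-suc≡ a = trans (cong ((k ∸ suc a) C suc (suc r) +_) (gain-eq a)) 
    (swap-+ ((k ∸ suc a) C suc (suc r)) (gain a) ((m + a) * (a C suc r)))
    where
    swap-+ : ∀ x y z → x + (y + z) ≡ y + (x + z)
    swap-+ = solve-∀

  keep : ∀ a → f (suc (suc r)) n k a ≤ f (suc (suc r)) n k (suc a) →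
         f (suc (suc r)) n k (suc a) ≤ f (suc (suc r)) n k (suc (suc a))
  keep a up = subst₂ _≤_ (sym (f≡ (suc a))) (sym (f-suc≡ (suc a))) (+-monoˡ-≤ (balance (suc a))
    (≤-trans (loss-anti a) (≤-trans
      (+-cancelʳ-≤ (balance a) _ _ (subst₂ _≤_ (f≡ a) (f-suc≡ a) up)) (gain-mono a))))

module _ {A : Set} where

  filterᵇ-comm : ∀ (p q : A → Bool) xs → filterᵇ p (filterᵇ q xs) ≡ filterᵇ q (filterᵇ p xs)
  filterᵇ-comm p q [] = refl
  filterᵇ-comm p q (x ∷ xs) with p x in px | q x in qx
  ... | true | true rewrite px | qx = cong (x ∷_) (filterᵇ-comm p q xs)
  ... | true | false rewrite qx = filterᵇ-comm p q xs
  ... | false | true rewrite px = filterᵇ-comm p q xs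
  ... | false | false = filterᵇ-comm p q xs

  filterᵇ-∧ : ∀ (p q : A → Bool) xs → filterᵇ (λ x → p x ∧ q x) xs ≡ filterᵇ q (filterᵇ p xs)
  filterᵇ-∧ p q [] = refl
  filterᵇ-∧ p q (x ∷ xs) with p x
  ... | false = filterᵇ-∧ p q xs
  ... | true with q x
  ... | true = cong (x ∷_) (filterᵇ-∧ p q xs)
  ... | false = filterᵇ-∧ p q xs

  count-mono : ∀ {p q : A → Bool} → (∀ x → p x ≡ true → q x ≡ true) → ∀ xs → count p xs ≤ count q xs
  count-mono h [] = z≤n
  count-mono {p} {q} h (x ∷ xs) with p x in px | q x in qx
  ... | true | true = s≤s (count-mono h xs)
  ... | false | true = m≤n⇒m≤1+n (count-mono h xs)
  ... | false | false = count-mono h xs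
  ... | true | false with trans (sym qx) (h x px)
  ... | ()

  count-≤-length : ∀ (p : A → Bool) xs → count p xs ≤ length xs
  count-≤-length p [] = z≤n
  count-≤-length p (x ∷ xs) with p x
  ... | true = s≤s (count-≤-length p xs)
  ... | false = m≤n⇒m≤1+n (count-≤-length p xs)

  filterᵇ-↭ : ∀ (p : A → Bool) {xs ys} → xs ↭ ys → filterᵇ p xs ↭ filterᵇ p ys
  filterᵇ-↭ p = filter-↭ _

  count-↭ : ∀ (p : A → Bool) {xs ys} → xs ↭ ys → count p xs ≡ count p ys
  count-↭ p e = ↭-length (filter-↭ _ e)

  count-map : ∀ {B : Set} (p : A → Bool) (g : B → A) xs → count p (map g xs) ≡ count (p ∘ g) xs
  count-map p g [] = refl
  count-map p g (x ∷ xs) with p (g x)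
  ... | true = cong suc (count-map p g xs)
  ... | false = count-map p g xs

module _ {n : ℕ} (G : Graph n) where

  -- Splitting by whether the head belongs to the clique makes deletion of a vertex a defining
  -- equation, and the cost of that deletion depends only on its neighbours in the rest. `cliques-↭`
  -- brings any vertex to the head.
  cliques : ℕ → List (Fin n) → ℕ
  cliques zero L = 1
  cliques (suc r) [] = 0
  cliques (suc r) (v ∷ L) = cliques (suc r) L + cliques r (filterᵇ (adj G v) L)

  -- Cliques through both vertices exist only if these are adjacent, and are then counted in the
  -- common neighbourhood, whichever filter comes first.
  cliques-swap : ∀ r v w L → cliques (suc r) (v ∷ w ∷ L) ≡ cliques (suc r) (w ∷ v ∷ L)
  cliques-swap r v w L rewrite Graph.sym G w v with adj G v w
  ... | false = swap-+ (cliques (suc r) L) (cliques r (filterᵇ (adj G w) L)) _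
    where
    swap-+ : ∀ x y z → (x + y) + z ≡ (x + z) + y
    swap-+ = solve-∀
  cliques-swap zero v w L | true = refl
  cliques-swap (suc r) v w L | true = trans
    (cong (λ M → cliques (suc (suc r)) L + cliques (suc r) (filterᵇ (adj G w) L)
               + (cliques (suc r) (filterᵇ (adj G v) L) + cliques r M))
      (filterᵇ-comm (adj G w) (adj G v) L))
    (swap-+ (cliques (suc (suc r)) L) (cliques (suc r) (filterᵇ (adj G w) L)) _ _)
    where
    swap-+ : ∀ x y z t → (x + y) + (z + t) ≡ (x + z) + (y + t)
    swap-+ = solve-∀

  cliques-↭ : ∀ r {L L′} → L ↭ L′ → cliques r L ≡ cliques r L′
  cliques-↭ zero _ = refl
  cliques-↭ (suc r) refl = refl
  cliques-↭ (suc r) (prep v e) = cong₂ _+_ (cliques-↭ (suc r) e) (cliques-↭ r (filter-↭ _ e))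
  cliques-↭ (suc r) (_↭_.trans e e′) = trans (cliques-↭ (suc r) e) (cliques-↭ (suc r) e′)
  cliques-↭ (suc r) (swap v w e) = trans (cliques-swap r v w _)
    (cong₂ _+_ (cong₂ _+_ (cliques-↭ (suc r) e) (cliques-↭ r (filter-↭ _ e)))
      (cliques-↭ r (filterᵇ-↭ (adj G w) (prep v e))))

  cliques-≤ : ∀ r L → cliques r L ≤ length L C r
  cliques-≤ zero L = ≤-reflexive (sym (C-zero (length L)))
  cliques-≤ (suc r) [] = z≤n
  cliques-≤ (suc r) (v ∷ L) = begin
    cliques (suc r) L + cliques r (filterᵇ (adj G v) L)
      ≤⟨ +-mono-≤ (cliques-≤ (suc r) L) (≤-trans (cliques-≤ r _) (C-monoˡ r (count-≤-length (adj G v) L))) ⟩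
    length L C suc r + length L C r                     ≡⟨ +-comm (length L C suc r) _ ⟩
    length L C r + length L C suc r                     ≡⟨ nCk+nC[k+1]≡[n+1]C[k+1] (length L) r ⟩
    suc (length L) C suc r                              ∎
    where open ≤-Reasoning

  -- Disintegration and cores

  data Disintegrates (d : ℕ) : List (Fin n) → List (Fin n) → Set where
    done : ∀ {H} → Disintegrates d H H
    delete : ∀ {H} as v bs → deg G v (as ++ bs) ≤ d → Disintegrates d (as ++ bs) H →
             Disintegrates d (as ++ v ∷ bs) H

  deg-delete : ∀ as v bs → deg G v (as ++ v ∷ bs) ≡ deg G v (as ++ bs)
  deg-delete as v bs = trans (count-↭ (adj G v) (shift v as bs)) irreflexive
    where
    irreflexive : deg G v (v ∷ as ++ bs) ≡ deg G v (as ++ bs)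
    irreflexive rewrite irrefl G v = refl

  length-delete : ∀ (as : List (Fin n)) v bs → length (as ++ v ∷ bs) ≡ suc (length (as ++ bs))
  length-delete as v bs = ↭-length (shift v as bs)

  Core : ℕ → List (Fin n) → Set
  Core d X = ∀ {v} → v ∈ X → d < deg G v X

  disintegrate : ∀ d U → ∃ λ H → Disintegrates d U H × Core d H
  disintegrate d U = go (length U) U ≤-refl
    where
    go : ∀ b U → length U ≤ b → ∃ λ H → Disintegrates d U H × Core d H
    go zero [] _ = [] , done , λ ()
    go (suc b) U U≤ with splitFirst (λ v → deg G v U ≤? d) U
    ... | inj₂ none = U , done , λ m → ≰⇒> (none m)
    ... | inj₁ (as , v , bs , refl , low , _)
      with go b (as ++ bs) (≤-pred (subst (_≤ suc b) (length-delete as v bs) U≤))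
    ... | H , dis , core = H , delete as v bs (subst (_≤ d) (deg-delete as v bs) low) dis , core

  unique-delete : ∀ as {v : Fin n} {bs} → Unique (as ++ v ∷ bs) → Unique (as ++ bs)
  unique-delete as u with unique-++⁻ as u
  ... | u₁ , u₂ , d = unique-++⁺ u₁ (proj₂ (unique-∷⁻ u₂)) λ a b → d a (there b)

  disintegrates-unique : ∀ {d U H} → Disintegrates d U H → Unique U → Unique H
  disintegrates-unique done u = u
  disintegrates-unique (delete as v bs _ dis) u = disintegrates-unique dis (unique-delete as u)

  -- While all of `X` is present, each of its vertices keeps more than `d` neighbours and cannot be
  -- the next one deleted. So the outcome contains every core, whatever the order of deletions.
  core-⊆ : ∀ {d U H X} → Disintegrates d U H → Unique X → X ⊆ U → Core d X → X ⊆ H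
  core-⊆ done _ X⊆ _ m = X⊆ m
  core-⊆ {d} {X = X} (delete as v bs low dis) uX X⊆ core = core-⊆ dis uX X⊆′ core
    where
    X⊆′ : X ⊆ as ++ bs
    X⊆′ m with ∈-++⁻ as (X⊆ m)
    ... | inj₁ a = ∈-++⁺ˡ a
    ... | inj₂ (there b) = ∈-++⁺ʳ as b
    ... | inj₂ (here refl) = ⊥-elim (<⇒≱ (core m) (begin
        deg G v X               ≤⟨ count-⊆ (adj G v) uX X⊆ ⟩
        deg G v (as ++ v ∷ bs)  ≡⟨ deg-delete as v bs ⟩
        deg G v (as ++ bs)      ≤⟨ low ⟩
        d                       ∎))
      where open ≤-Reasoning

  -- The count stops as soon as `q` vertices are left, even if the deletions go on: from there the
  -- trivial bound `q C suc r` is used. Each earlier deletion costs at most `d C r`.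
  disintegrates-cliques : ∀ {d U H} q r → Disintegrates d U H → length H ≤ q → q ≤ length U →
    cliques (suc r) U ≤ q C suc r + (length U ∸ q) * (d C r)
  disintegrates-cliques {d} {U} q r dis H≤ q≤ with m≤n⇒m<n∨m≡n q≤
  ... | inj₂ refl = ≤-trans (cliques-≤ (suc r) U) (m≤m+n _ _)
  disintegrates-cliques q r done H≤ q≤ | inj₁ q< = ⊥-elim (<⇒≱ q< H≤)
  disintegrates-cliques {d} q r (delete as v bs low dis) H≤ q≤ | inj₁ q< = begin
      cliques (suc r) (as ++ v ∷ bs)     ≡⟨ cliques-↭ (suc r) (shift v as bs) ⟩
      cliques (suc r) (as ++ bs) + cliques r (filterᵇ (adj G v) (as ++ bs))
        ≤⟨ +-mono-≤ (disintegrates-cliques q r dis H≤ q≤′)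
             (≤-trans (cliques-≤ r _) (C-monoˡ r low)) ⟩
      q C suc r + (length (as ++ bs) ∸ q) * (d C r) + d C r
        ≡⟨ collect (q C suc r) (length (as ++ bs) ∸ q) (d C r) ⟩
      q C suc r + suc (length (as ++ bs) ∸ q) * (d C r)
        ≡⟨ cong (λ l → q C suc r + l * (d C r)) (sym (+-∸-assoc 1 q≤′)) ⟩
      q C suc r + (suc (length (as ++ bs)) ∸ q) * (d C r)
        ≡⟨ cong (λ l → q C suc r + (l ∸ q) * (d C r)) (sym (length-delete as v bs)) ⟩
      q C suc r + (length (as ++ v ∷ bs) ∸ q) * (d C r) ∎
    where
    open ≤-Reasoning
    q≤′ : q ≤ length (as ++ bs)
    q≤′ = ≤-pred (subst (q <_) (length-delete as v bs) q<)
    collect : ∀ a b c → a + b * c + c ≡ a + suc b * c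
    collect = solve-∀

  -- From clique subsets to clique counts on lists

  module _ {m : ℕ} (φ : Fin m → Fin n) where

    record CliqueSet (ok : Fin n → Bool) (r : ℕ) (S : Subset m) : Set where
      field
        size : ∣ S ∣ ≡ r
        allowed : ∀ i → Vec.lookup S i ≡ true → ok (φ i) ≡ true
        adjacent : ∀ i j → i ≢ j → Vec.lookup S i ≡ true → Vec.lookup S j ≡ true → Adj G (φ i) (φ j)

  open CliqueSet

  -- The generality serves the induction on `m`: `φ` enumerates the vertices still undecided, and
  -- `ok` collects adjacency to those already chosen.
  cliqueSets-≤ : ∀ {m} (φ : Fin m → Fin n) ok r (Q : Subset m → Bool) →
    (∀ S → Q S ≡ true → CliqueSet φ ok r S) →
    count Q (allSubsets m) ≤ cliques r (filterᵇ ok (tabulate φ))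
  cliqueSets-≤ {zero} φ ok r Q h with Q Vec.[] in eq
  ... | false = z≤n
  ... | true with size (h Vec.[] eq)
  ... | refl = ≤-refl
  cliqueSets-≤ {suc m} φ ok r Q h = begin
      count Q (map (true Vec.∷_) A ++ map (false Vec.∷_) A)
        ≡⟨ count-++ Q (map (true Vec.∷_) A) _ ⟩
      count Q (map (true Vec.∷_) A) + count Q (map (false Vec.∷_) A)
        ≡⟨ cong₂ _+_ (count-map Q (true Vec.∷_) A) (count-map Q (false Vec.∷_) A) ⟩
      count Q₁ A + count Q₀ A       ≡⟨ +-comm (count Q₁ A) _ ⟩
      count Q₀ A + count Q₁ A       ≤⟨ bound r h (cliqueSets-≤ (φ ∘ suc) ok r Q₀ without) ⟩
      cliques r (filterᵇ ok (tabulate φ)) ∎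
    where
    open ≤-Reasoning
    A = allSubsets m
    Q₁ Q₀ : Subset m → Bool
    Q₁ S = Q (true Vec.∷ S)
    Q₀ S = Q (false Vec.∷ S)

    without : ∀ S → Q₀ S ≡ true → CliqueSet (φ ∘ suc) ok r S
    without S q = record
      { size = size c
      ; allowed = λ i → allowed c (suc i)
      ; adjacent = λ i j i≢j → adjacent c (suc i) (suc j) λ { refl → i≢j refl } }
      where c = h _ q

    Q₁-none : (∀ S → Q₁ S ≢ true) → count Q₁ A ≡ 0
    Q₁-none none = count-none Q₁ {A} λ {S} _ → none S

    bound : ∀ r → (∀ S → Q S ≡ true → CliqueSet φ ok r S) →
      count Q₀ A ≤ cliques r (filterᵇ ok (tabulate (φ ∘ suc))) →
      count Q₀ A + count Q₁ A ≤ cliques r (filterᵇ ok (tabulate φ))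
    bound r h ih with ok (φ zero) in ok₀
    ... | false = ≤-trans (≤-reflexive (trans (cong (count Q₀ A +_) (Q₁-none disallowed)) (+-identityʳ _))) ih
      where
      disallowed : ∀ S → Q₁ S ≢ true
      disallowed S q with trans (sym ok₀) (allowed (h _ q) zero refl)
      ... | ()
    bound zero h ih | true = ≤-trans (≤-reflexive (trans (cong (count Q₀ A +_) (Q₁-none nonempty)) (+-identityʳ _))) ih
      where
      nonempty : ∀ S → Q₁ S ≢ true
      nonempty S q with size (h _ q)
      ... | ()
    bound (suc r) h ih | true = +-mono-≤ ih (subst (λ l → count Q₁ A ≤ cliques r l)
      (filterᵇ-∧ ok (adj G (φ zero)) (tabulate (φ ∘ suc)))
      (cliqueSets-≤ (φ ∘ suc) (λ v → ok v ∧ adj G (φ zero) v) r Q₁ λ S q → let c = h _ q in record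
        { size = suc-injective (size c)
        ; allowed = λ i p → cong₂ _∧_ (allowed c (suc i) p) (adjacent c zero (suc i) (λ ()) refl p)
        ; adjacent = λ i j i≢j → adjacent c (suc i) (suc j) λ { refl → i≢j refl } }))

module _ {A : Set} where

  and-map⁻ : ∀ (p : A → Bool) {x} xs → and (map p xs) ≡ true → x ∈ xs → p x ≡ true
  and-map⁻ p (x ∷ xs) h (here refl) with p x
  ... | true = refl
  and-map⁻ p (x ∷ xs) h (there m) with p x
  ... | true = and-map⁻ p xs h m

  and-map-mono : ∀ (p q : A → Bool) → (∀ x → p x ≡ true → q x ≡ true) →
                 ∀ xs → and (map p xs) ≡ true → and (map q xs) ≡ true
  and-map-mono p q h [] _ = refl
  and-map-mono p q h (x ∷ xs) e with p x in px
  ... | true rewrite h x px = and-map-mono p q h xs e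

N≤cliques : ∀ {n} (G : Graph n) s → N s G ≤ cliques G s (allFin n)
N≤cliques {n} G s = subst (λ l → N s G ≤ cliques G s l) (filterᵇ-true (allFin n))
  (cliqueSets-≤ G (λ i → i) (λ _ → true) s (isSClique G s) cliqueSet)
  where
  filterᵇ-true : ∀ xs → filterᵇ (λ (_ : Fin n) → true) xs ≡ xs
  filterᵇ-true [] = refl
  filterᵇ-true (x ∷ xs) = cong (x ∷_) (filterᵇ-true xs)
  cliqueSet : ∀ S → isSClique G s S ≡ true → CliqueSet G (λ i → i) (λ _ → true) s S
  cliqueSet S h with ∣ S ∣ Data.Nat.≟ s
  ... | yes eq = record { size = eq ; allowed = λ _ _ → refl ; adjacent = adjacent′ }
    where
    adjacent′ : ∀ i j → i ≢ j → Vec.lookup S i ≡ true → Vec.lookup S j ≡ true → Adj G i j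
    adjacent′ i j i≢j Si Sj with and-map⁻ _ (allFin n) (and-map⁻ _ (allFin n) h (∈-allFin i)) (∈-allFin j)
    ... | e rewrite Si | Sj with i Fin.≟ j
    ... | yes i≡j = ⊥-elim (i≢j i≡j)
    ... | no _ = e

N-mono : ∀ {n} {G G′ : Graph n} s → (∀ {i j} → Adj G i j → Adj G′ i j) → N s G ≤ N s G′
N-mono {n} {G} {G′} s h = count-mono cliqueMono (allSubsets n)
  where
  pairMono : ∀ (S : Subset n) i j → not (Vec.lookup S i ∧ Vec.lookup S j) ∨ ⌊ i Fin.≟ j ⌋ ∨ adj G i j ≡ true →
    not (Vec.lookup S i ∧ Vec.lookup S j) ∨ ⌊ i Fin.≟ j ⌋ ∨ adj G′ i j ≡ true
  pairMono S i j e with not (Vec.lookup S i ∧ Vec.lookup S j) | ⌊ i Fin.≟ j ⌋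
  ... | true | _ = refl
  ... | false | true = refl
  ... | false | false = h e
  cliqueMono : ∀ S → isSClique G s S ≡ true → isSClique G′ s S ≡ true
  cliqueMono S e with ⌊ ∣ S ∣ Data.Nat.≟ s ⌋
  ... | true = and-map-mono _ _ (λ i → and-map-mono _ _ (pairMono S i) (allFin n)) (allFin n) e

-- Saturation

count-mono-< : ∀ {A : Set} {p q : A → Bool} → (∀ x → p x ≡ true → q x ≡ true) →
               ∀ {z xs} → z ∈ xs → p z ≡ false → q z ≡ true → count p xs < count q xs
count-mono-< h {xs = x ∷ xs} (here refl) pz qz rewrite pz | qz = s≤s (count-mono h xs)
count-mono-< {p = p} {q} h {xs = x ∷ xs} (there m) pz qz with p x in px | q x in qx
... | true | true = s≤s (count-mono-< h m pz qz)
... | false | true = m≤n⇒m≤1+n (count-mono-< h m pz qz)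
... | false | false = count-mono-< h m pz qz
... | true | false with trans (sym qx) (h x px)
... | ()

closedWalk-trivial : ∀ {A : Set} {R : A → A → Set} {u xs} → Walk R u xs u → Unique xs → length xs ≡ 1
closedWalk-trivial end _ = refl
closedWalk-trivial (_ ◂ p) u = ⊥-elim (proj₁ (unique-∷⁻ u) (last∈ p))

module AddEdge {n : ℕ} (G : Graph n) (x y : Fin n) (x≢y : x ≢ y) where

  New : Fin n → Fin n → Set
  New i j = (i ≡ x × j ≡ y) ⊎ (i ≡ y × j ≡ x)

  isNew : Fin n → Fin n → Bool
  isNew i j = (⌊ i Fin.≟ x ⌋ ∧ ⌊ j Fin.≟ y ⌋) ∨ (⌊ i Fin.≟ y ⌋ ∧ ⌊ j Fin.≟ x ⌋)

  isNew-irrefl : ∀ i → isNew i i ≡ false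
  isNew-irrefl i with i Fin.≟ x | i Fin.≟ y
  ... | yes refl | yes refl = ⊥-elim (x≢y refl)
  ... | yes _ | no _ = refl
  ... | no _ | yes _ = refl
  ... | no _ | no _ = refl

  isNew⇒New : ∀ i j → isNew i j ≡ true → New i j
  isNew⇒New i j e with i Fin.≟ x | j Fin.≟ y | i Fin.≟ y | j Fin.≟ x
  ... | yes p | yes q | _ | _ = inj₁ (p , q)
  ... | yes _ | no _ | yes p | yes q = inj₂ (p , q)
  ... | no _ | _ | yes p | yes q = inj₂ (p , q)

  G⁺ : Graph n
  G⁺ = record
    { adj = λ i j → adj G i j ∨ isNew i j
    ; sym = λ i j → cong₂ _∨_ (Graph.sym G i j) (trans (Bool.∨-comm (⌊ i Fin.≟ x ⌋ ∧ ⌊ j Fin.≟ y ⌋) _)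
        (cong₂ _∨_ (Bool.∧-comm ⌊ i Fin.≟ y ⌋ _) (Bool.∧-comm ⌊ i Fin.≟ x ⌋ _)))
    ; irrefl = λ i → cong₂ _∨_ (irrefl G i) (isNew-irrefl i)
    }

  old : ∀ {i j} → Adj G i j → Adj G⁺ i j
  old {i} {j} e = cong (_∨ isNew i j) e

  old-or-new : ∀ {i j} → Adj G⁺ i j → Adj G i j ⊎ New i j
  old-or-new {i} {j} e with adj G i j
  ... | true = inj₁ refl
  ... | false = inj₂ (isNew⇒New i j e)

  xy-new : Adj G⁺ x y
  xy-new with x Fin.≟ x | y Fin.≟ y
  ... | yes _ | yes _ = Bool.∨-zeroʳ (adj G x y)
  ... | no x≢x | _ = ⊥-elim (x≢x refl)
  ... | yes _ | no y≢y = ⊥-elim (y≢y refl)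

  twoConnected⁺ : TwoConnected G → TwoConnected G⁺
  twoConnected⁺ (3≤n , conn) = 3≤n , λ w u v u≢w v≢w → lift (conn w u v u≢w v≢w)
    where
    lift : ∀ {w u v} → WalkAvoiding G w u v → WalkAvoiding G⁺ w u v
    lift here = here
    lift (step e x≢w p) = step (old e) x≢w (lift p)

  firstNew : ∀ {u L v} → Walk (Adj G⁺) u L v → Walk (Adj G) u L v ⊎
    ∃ λ as → ∃ λ a → ∃₂ λ b bs → L ≡ (as ++ [ a ]) ++ b ∷ bs × Walk (Adj G) u (as ++ [ a ]) a × New a b
      × Walk (Adj G⁺) b (b ∷ bs) v
  firstNew end = inj₁ end
  firstNew (e ◂ p) with old-or-new e
  ... | inj₂ new with walk-head p
  ... | bs , refl = inj₂ ([] , _ , _ , bs , refl , end , new , p)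
  firstNew (e ◂ p) | inj₁ e′ with firstNew p
  ... | inj₁ q = inj₁ (e′ ◂ q)
  ... | inj₂ (as , a , b , bs , refl , q , new , r) = inj₂ (_ ∷ as , a , b , bs , refl , e′ ◂ q , new , r)

  LongPath : ℕ → Set
  LongPath k = ∃ λ L → Walk (Adj G) x L y × Unique L × k ≤ length L

  new-path : ∀ {k a b L} → New a b → Walk (Adj G) b L a → Unique L → k ≤ length L → LongPath k
  new-path {L = L} (inj₁ (refl , refl)) p u k≤ = _ , walk-reverse (adj-sym G) p , unique-reverse u
    , ≤-trans k≤ (≤-reflexive (sym (length-reverse L)))
  new-path (inj₂ (refl , refl)) p u k≤ = _ , p , u , k≤

  new-meets : ∀ {a b i j} → New a b → New i j → i ≡ a ⊎ j ≡ a
  new-meets (inj₁ (refl , refl)) (inj₁ (refl , refl)) = inj₁ refl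
  new-meets (inj₁ (refl , refl)) (inj₂ (refl , refl)) = inj₂ refl
  new-meets (inj₂ (refl , refl)) (inj₁ (refl , refl)) = inj₂ refl
  new-meets (inj₂ (refl , refl)) (inj₂ (refl , refl)) = inj₁ refl

  new-opposite : ∀ {a b i j} → New a b → New i j → i ≢ a → i ≡ b × j ≡ a
  new-opposite (inj₁ (refl , refl)) (inj₁ (refl , refl)) i≢a = ⊥-elim (i≢a refl)
  new-opposite (inj₁ (refl , refl)) (inj₂ (refl , refl)) i≢a = refl , refl
  new-opposite (inj₂ (refl , refl)) (inj₁ (refl , refl)) i≢a = refl , refl
  new-opposite (inj₂ (refl , refl)) (inj₂ (refl , refl)) i≢a = ⊥-elim (i≢a refl)

  -- Rotate the cycle so that its first new edge becomes the closing one. Any further new edge would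
  -- meet `a` again, so the rest is a path of `G` between the two joined vertices.
  longCycle⁺ : ∀ {k u L v} → Walk (Adj G⁺) u L v → Unique L → Adj G⁺ v u → 3 ≤ length L → k ≤ length L →
               LongCycle G k ⊎ LongPath k
  longCycle⁺ p uL e 3≤ k≤ with firstNew p | old-or-new e
  ... | inj₁ q | inj₁ e′ = inj₁ (_ , _ , _ , q , e′ , uL , k≤)
  ... | inj₁ q | inj₂ new = inj₂ (new-path new q uL k≤)
  ... | inj₂ (as , a , b , bs , refl , q , new , r) | closing with unique-++⁻ (as ++ [ a ]) uL
  ... | u₁ , u₂ , disj = inj₂ (new-path new (append r′ (e′ closing) q)
          (unique-++⁺ u₂ u₁ λ m m′ → disj m′ m)
          (≤-trans k≤ (≤-reflexive (trans (length-++ (as ++ [ a ]))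
            (trans (+-comm (length (as ++ [ a ])) _) (sym (length-++ (b ∷ bs) {as ++ [ a ]})))))))
    where
    a∉ : a ∉ b ∷ bs
    a∉ = disj (∈-++⁺ʳ as (here refl))
    r′ : Walk (Adj G) b (b ∷ bs) _
    r′ = walk-map (λ i∈ j∈ e → [ (λ e′ → e′) , (λ new′ → ⊥-elim
      ([ (λ { refl → a∉ i∈ }) , (λ { refl → a∉ j∈ }) ]′ (new-meets new new′))) ]′ (old-or-new e)) r
    e′ : Adj G _ _ ⊎ New _ _ → Adj G _ _
    e′ (inj₁ e′) = e′
    -- If the closing edge were new as well, both pieces would begin and end at the same vertex,
    -- leaving a cycle of two vertices against `3 ≤ length L`.
    e′ (inj₂ new′) with new-opposite new new′ (λ { refl → a∉ (last∈ r) })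
    ... | refl , refl = ⊥-elim (<⇒≱ 3≤ (≤-reflexive (trans (length-++ (as ++ [ a ]))
      (cong₂ _+_ (closedWalk-trivial q u₁) (closedWalk-trivial r u₂)))))

  circumference⁺ : ∀ {k} → 3 ≤ k → CircumferenceLessThan G k → ¬ LongPath k → CircumferenceLessThan G⁺ k
  circumference⁺ {k} 3≤k circ noPath ℓ (3≤ℓ , c , inj , steps , closing) with ℓ <? k
  ... | yes ℓ<k = ℓ<k
  circumference⁺ {k} 3≤k circ noPath (suc ℓ) (3≤ℓ , c , inj , steps , closing) | no ℓ≮k
    with tabulate-walk G c steps
  ... | j , j-last , p with longCycle⁺ p (Unique.tabulate⁺ inj) (closing zero j refl j-last)
                             (subst (3 ≤_) (sym (length-tabulate c)) 3≤ℓ)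
                             (subst (k ≤_) (sym (length-tabulate c)) (≮⇒≥ ℓ≮k))
  ... | inj₂ path = ⊥-elim (noPath path)
  ... | inj₁ cycle with longCycle⇒ G 3≤k cycle
  ... | m , k≤m , cyc = ⊥-elim (<⇒≱ (circ m cyc) k≤m)

-- Ordered pairs, diagonal included: only the strict decrease under adding an edge matters.
nonEdges : ∀ {n} → Graph n → ℕ
nonEdges {n} G = count (λ (i , j) → not (adj G i j)) (cartesianProduct (allFin n) (allFin n))

nonEdges-addEdge : ∀ {n} (G : Graph n) {x y} (x≢y : x ≢ y) → ¬ Adj G x y →
                   nonEdges (AddEdge.G⁺ G x y x≢y) < nonEdges G
nonEdges-addEdge {n} G {x} {y} x≢y x≁y = count-mono-< shrink
  (∈-cartesianProduct⁺ (∈-allFin x) (∈-allFin y)) (cong not (AddEdge.xy-new G x y x≢y))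
  (cong not (Bool.¬-not x≁y))
  where
  shrink : ∀ ((i , j) : Fin n × Fin n) → not (adj (AddEdge.G⁺ G x y x≢y) i j) ≡ true → not (adj G i j) ≡ true
  shrink (i , j) e with adj G i j
  ... | false = refl

-- Saturated graphs and their cores

module _ {n : ℕ} (G : Graph n) where

  open DecMembership (Fin._≟_ {n}) using (_∈?_)

  length-≤ : ∀ {L : List (Fin n)} → Unique L → length L ≤ n
  length-≤ {L} u = subst (length L ≤_) (length-tabulate (λ i → i)) (length-⊆ u λ {v} _ → ∈-allFin v)

  thirdVertex : 3 ≤ n → ∀ (a b : Fin n) → ∃ λ c → c ≢ a × c ≢ b
  thirdVertex 3≤n a b with splitFirst (λ c → ¬? (c ∈? (a ∷ b ∷ []))) (allFin n)
  ... | inj₁ (_ , c , _ , _ , c∉ , _) = c , (λ { refl → c∉ (here refl) }) , λ { refl → c∉ (there (here refl)) }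
  ... | inj₂ none = ⊥-elim (<⇒≱ 3≤n (subst (_≤ 2) (length-tabulate (λ i → i))
      (length-⊆ {ys = a ∷ b ∷ []} (Unique.allFin⁺ n) covered)))
    where
    covered : allFin n ⊆ a ∷ b ∷ []
    covered {v} m with v ∈? (a ∷ b ∷ [])
    ... | yes v∈ = v∈
    ... | no v∉ = ⊥-elim (none m v∉)

  neighbourAvoiding : TwoConnected G → ∀ {w v} → v ≢ w → ∃ λ u → Adj G v u × u ≢ w
  neighbourAvoiding (3≤n , conn) {w} {v} v≢w with thirdVertex 3≤n v w
  ... | c , c≢v , c≢w with conn w v c v≢w c≢w
  ... | here = ⊥-elim (c≢v refl)
  ... | step e u≢w _ = _ , e , u≢w

  -- One neighbour `u` comes from any walk leaving `v`; a walk leaving `v` that avoids `u` begins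
  -- with a second one.
  twoConnected⇒core : TwoConnected G → Core G 1 (allFin n)
  twoConnected⇒core conn@(3≤n , _) {v} _ with thirdVertex 3≤n v v
  ... | w , w≢v , _ with neighbourAvoiding conn {w} {v} (λ { refl → w≢v refl })
  ... | u , v~u , _ with neighbourAvoiding conn {u} {v} (adj⇒≢ G v~u)
  ... | u′ , v~u′ , u′≢u = length-⊆ {xs = u ∷ u′ ∷ []} (unique-∷⁺ (λ { (here refl) → u′≢u refl }) ([] ∷ []))
    λ { (here refl) → ∈-filterᵇ⁺ (adj G v) (∈-allFin _) v~u
      ; (there (here refl)) → ∈-filterᵇ⁺ (adj G v) (∈-allFin _) v~u′ }

  clique-walk : ∀ u L → Unique (u ∷ L) → (∀ {a b} → a ∈ u ∷ L → b ∈ u ∷ L → a ≢ b → Adj G a b) →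
                ∃ λ v → Walk (Adj G) u (u ∷ L) v
  clique-walk u [] _ _ = u , end
  clique-walk u (w ∷ L) uq h with clique-walk w L (proj₂ (unique-∷⁻ uq)) (λ a b → h (there a) (there b))
  ... | v , p = v , h (here refl) (there (here refl)) (λ { refl → proj₁ (unique-∷⁻ uq) (here refl) }) ◂ p

  clique⇒longCycle : ∀ L → Unique L → (∀ {a b} → a ∈ L → b ∈ L → a ≢ b → Adj G a b) → 2 ≤ length L →
                     LongCycle G (length L)
  clique⇒longCycle (u ∷ w ∷ L) uq h _ with clique-walk u (w ∷ L) uq h
  ... | v , p = _ , u , v , p , h (last∈ p) (here refl) (v≢u p) , uq , ≤-refl
    where
    v≢u : ∀ {v} → Walk (Adj G) u (u ∷ w ∷ L) v → v ≢ u
    v≢u (e ◂ p) refl = proj₁ (unique-∷⁻ uq) (last∈ p)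
  clique⇒longCycle (u ∷ []) _ _ (s≤s ())

  deg<length : ∀ {v L} → Unique L → v ∈ L → deg G v L < length L
  deg<length {v} {L} u v∈ = length-⊆ {xs = v ∷ filterᵇ (adj G v) L}
    (unique-∷⁺ (λ m → adj⇒≢ G (proj₂ (∈-filterᵇ⁻ (adj G v) L m)) refl) (unique-filterᵇ _ u))
    λ { (here refl) → v∈ ; (there m) → proj₁ (∈-filterᵇ⁻ (adj G v) L m) }

  length≤deg : ∀ {v L} → Unique L → (∀ {w} → w ∈ L → v ≢ w → Adj G v w) → length L ≤ suc (deg G v L)
  length≤deg {v} {L} u h = length-⊆ {ys = v ∷ filterᵇ (adj G v) L} u sub
    where
    sub : L ⊆ v ∷ filterᵇ (adj G v) L
    sub {w} m with v Fin.≟ w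
    ... | yes refl = here refl
    ... | no v≢w = there (∈-filterᵇ⁺ (adj G v) m (h m v≢w))

  -- The long path is given only under a double negation. This is what the induction provides, and
  -- it is enough because `joined` uses the path to reach a contradiction.
  module Saturated {k : ℕ} (conn : TwoConnected G) (noCycle : ¬ LongCycle G k)
    (saturated : ∀ {x y} (x≢y : x ≢ y) → ¬ Adj G x y → ¬ ¬ AddEdge.LongPath G x y x≢y k) where

    deg-path : ∀ {x X L} → Unique X → (∀ {u} → u ∈ X → ¬ (Adj G x u × u ∉ L)) → deg G x X ≤ deg G x L
    deg-path {x} {X} {L} uX inL = length-⊆ (unique-filterᵇ (adj G x) uX) sub
      where
      sub : filterᵇ (adj G x) X ⊆ filterᵇ (adj G x) L
      sub {u} m with ∈-filterᵇ⁻ (adj G x) X m | u ∈? L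
      ... | u∈X , x~u | yes u∈L = ∈-filterᵇ⁺ (adj G x) u∈L x~u
      ... | u∈X , x~u | no u∉L = ⊥-elim (inL u∈X (x~u , u∉L))

    -- A path between nonadjacent x ∈ X and y ∈ Y is lengthened at its ends within X and Y; when this is
    -- no longer possible, all neighbours of x in X and of y in Y lie on it and Kopylov's lemma applies.
    joined : ∀ {X Y : List (Fin n)} {dx dy} → Unique X → Unique Y →
      (∀ {v} → v ∈ X → dx ≤ deg G v X) → (∀ {v} → v ∈ Y → dy ≤ deg G v Y) → k ≤ dx + dy →
      ∀ {x y} → x ∈ X → y ∈ Y → x ≢ y → Adj G x y
    joined {X} {Y} uX uY degX degY k≤ {x} {y} x∈ y∈ x≢y with adj? G x y
    ... | yes x~y = x~y
    ... | no x≁y = ⊥-elim (saturated x≢y x≁y λ (L , p , u , k≤L) →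
        extend (suc n) L (m≤n+m (suc n) (length L)) x∈ y∈ x≢y x≁y p u k≤L)
      where
      fresh? : ∀ v L → Decidable (λ u → Adj G v u × u ∉ L)
      fresh? v L u = adj? G v u ×-dec ¬? (u ∈? L)

      extend : ∀ fuel L → n < length L + fuel → ∀ {x y} → x ∈ X → y ∈ Y → x ≢ y → ¬ Adj G x y →
               Walk (Adj G) x L y → Unique L → k ≤ length L → ⊥
      -- Every extension trades one unit of fuel for one vertex, so exhausted fuel means a path on
      -- more than `n` vertices.
      extend zero L n< _ _ _ _ _ u _ = <⇒≱ (subst (n <_) (+-identityʳ _) n<) (length-≤ u)
      extend (suc fuel) L n< {x} {y} x∈ y∈ x≢y x≁y p u k≤L
        with splitFirst (fresh? x L) X | splitFirst (fresh? y L) Y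
      -- Either `x′` is adjacent to y and the longer path closes at once, or `x′` and y are again
      -- nonadjacent; `x′` lies in `X`, so the degree bound carries over.
      ... | inj₁ (as , x′ , bs , refl , (x~x′ , x′∉) , _) | _ with adj? G x′ y
      ... | yes x′~y = noCycle (x′ ∷ L , x′ , y , adj-sym G x~x′ ◂ p , adj-sym G x′~y
                               , unique-∷⁺ x′∉ u , m≤n⇒m≤1+n k≤L)
      ... | no x′≁y = extend fuel (x′ ∷ L) (subst (n <_) (+-suc _ fuel) n<)
                        (∈-++⁺ʳ as (here refl)) y∈ (λ { refl → x′∉ (last∈ p) }) x′≁y
                        (adj-sym G x~x′ ◂ p) (unique-∷⁺ x′∉ u) (m≤n⇒m≤1+n k≤L)
      extend (suc fuel) L n< {x} {y} x∈ y∈ x≢y x≁y p u k≤L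
          | inj₂ _ | inj₁ (as , y′ , bs , refl , (y~y′ , y′∉) , _) with adj? G x y′
      ... | yes x~y′ = noCycle (L ++ [ y′ ] , x , y′ , append p y~y′ end , adj-sym G x~y′ , uL , k≤′)
        where
        uL = unique-++⁺ u ([] ∷ []) λ { m (here refl) → y′∉ m }
        k≤′ = ≤-trans k≤L (≤-trans (m≤m+n _ 1) (≤-reflexive (sym (length-++ L))))
      ... | no x≁y′ = extend fuel (L ++ [ y′ ])
                        (subst (n <_) (trans (sym (+-assoc (length L) 1 fuel)) (cong (_+ fuel) (sym (length-++ L)))) n<)
                        x∈ (∈-++⁺ʳ as (here refl)) (λ { refl → y′∉ (head∈ p) }) x≁y′
                        (append p y~y′ end) uL k≤′
        where
        uL = unique-++⁺ u ([] ∷ []) λ { m (here refl) → y′∉ m }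
        k≤′ = ≤-trans k≤L (≤-trans (m≤m+n _ 1) (≤-reflexive (sym (length-++ L))))
      extend (suc fuel) L n< {x} {y} x∈ y∈ x≢y x≁y p u k≤L | inj₂ xIn | inj₂ yIn =
        noCycle (kopylov G conn p u x≢y k≤L (≤-trans k≤ (+-mono-≤
          (≤-trans (degX x∈) (deg-path {L = L} uX xIn)) (≤-trans (degY y∈) (deg-path {L = L} uY yIn)))))

    disintegrates-f : ∀ r a {H} → k ≤ n → a ≤ k → Disintegrates G a (allFin n) H → length H ≤ k ∸ a →
                      cliques G (suc r) (allFin n) ≤ f (suc r) n k a
    disintegrates-f r a k≤n a≤k dis H≤ = subst (λ m → cliques G (suc r) (allFin n) ≤ (k ∸ a) C suc r + m * (a C r))
      remaining (disintegrates-cliques G (k ∸ a) r dis H≤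
        (subst (k ∸ a ≤_) (sym (length-tabulate (λ i → i))) (≤-trans (m∸n≤m k a) k≤n)))
      where
      remaining : length (allFin n) ∸ (k ∸ a) ≡ (n ∸ k) + a
      remaining = begin
        length (allFin n) ∸ (k ∸ a)   ≡⟨ cong (_∸ (k ∸ a)) (length-tabulate (λ i → i)) ⟩
        n ∸ (k ∸ a)                   ≡⟨ cong (_∸ (k ∸ a)) (sym (m∸n+n≡m k≤n)) ⟩
        ((n ∸ k) + k) ∸ (k ∸ a)       ≡⟨ +-∸-assoc (n ∸ k) (m∸n≤m k a) ⟩
        (n ∸ k) + (k ∸ (k ∸ a))       ≡⟨ cong ((n ∸ k) +_) (m∸[m∸n]≡n a≤k) ⟩
        (n ∸ k) + a                   ∎
        where open ≡-Reasoning

    core-clique : ∀ {d H} → k ≤ suc d + suc d → Unique H → Core G d H →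
                  ∀ {u v} → u ∈ H → v ∈ H → u ≢ v → Adj G u v
    core-clique k≤ uH core = joined uH uH core core k≤

    core-length : ∀ {d H v} → Unique H → Core G d H → v ∈ H → suc (suc d) ≤ length H
    core-length uH core v∈ = ≤-trans (s≤s (core v∈)) (deg<length uH v∈)

    -- A vertex of H′ outside the clique H is adjacent to all of H, so H could not have excluded it.
    largerCore-⊆ : ∀ {t H H′} → k ≤ n → length H < k →
      Disintegrates G t (allFin n) H → Core G t H → Unique H →
      (∀ {u v} → u ∈ H → v ∈ H → u ≢ v → Adj G u v) → suc (suc t) ≤ length H →
      Unique H′ → Core G (k ∸ length H) H′ → H′ ⊆ H
    largerCore-⊆ {t} {H} {H′} k≤n H<k dis core uH complete t+2≤ uH′ core′ {y} y∈ with y ∈? H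
    ... | yes y∈H = y∈H
    ... | no y∉H = ⊥-elim (y∉H (core-⊆ G dis (unique-∷⁺ y∉H uH) (λ {v} _ → ∈-allFin v) core⁺ (here refl)))
      where
      open ≤-Reasoning
      r = length H
      -- This sum fixes the second threshold: a vertex of the clique has only r - 1 neighbours in
      -- `H`, so a vertex of `H′` must bring k - r + 1.
      large : k ≤ (r ∸ 1) + suc (k ∸ r)
      large = begin
        k                        ≡⟨ sym (m+[n∸m]≡n (<⇒≤ H<k)) ⟩
        r + (k ∸ r)              ≤⟨ +-monoˡ-≤ (k ∸ r) (m≤n+m∸n r 1) ⟩
        suc (r ∸ 1) + (k ∸ r)    ≡⟨ sym (+-suc (r ∸ 1) (k ∸ r)) ⟩
        (r ∸ 1) + suc (k ∸ r)    ∎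
      adjacent : ∀ {u} → u ∈ H → Adj G u y
      adjacent u∈ = joined uH uH′ (λ v∈ → m≤n+o⇒m∸n≤o r 1 (length≤deg uH (complete v∈)))
        core′ large u∈ y∈ λ { refl → y∉H u∈ }
      core⁺ : Core G t (y ∷ H)
      core⁺ (there m) = ≤-trans (core m) (count-⊆ (adj G _) uH there)
      core⁺ (here refl) = ≤-trans (≤-trans (n≤1+n (suc t)) t+2≤) (length-⊆ uH
        λ m → ∈-filterᵇ⁺ (adj G y) (there m) (adj-sym G (adjacent m)))

    cliques-bound : ∀ {t} r → k ≤ n → 2 ≤ k → t ≤ k → k ≤ suc t + suc t →
      ∃ λ a → (a ≡ t ⊎ 2 ≤ a × a ≤ t) × cliques G (suc r) (allFin n) ≤ f (suc r) n k a
    cliques-bound {t} r k≤n 2≤k t≤k k≤2t+2 with disintegrate G t (allFin n)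
    ... | [] , dis , _ = t , inj₁ refl , disintegrates-f r t k≤n t≤k dis z≤n
    ... | H@(h ∷ _) , dis , core = a , inj₂ (2≤a , a≤t)
          , disintegrates-f r a k≤n (m∸n≤m k (length H)) (proj₁ (proj₂ larger))
              (subst (length H′ ≤_) (sym (m∸[m∸n]≡n (<⇒≤ H<k))) (length-⊆ uH′ H′⊆H))
      where
      uV : Unique (allFin n)
      uV = Unique.allFin⁺ n
      uH : Unique H
      uH = disintegrates-unique G dis uV
      complete : ∀ {u v} → u ∈ H → v ∈ H → u ≢ v → Adj G u v
      complete = core-clique k≤2t+2 uH core
      t+2≤ : suc (suc t) ≤ length H
      t+2≤ = core-length uH core (here refl)
      H<k : length H < k
      H<k = ≰⇒> λ k≤H →
        let L , u , v , p , e , uL , long = clique⇒longCycle H uH complete (≤-trans (s≤s (s≤s z≤n)) t+2≤)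
        in noCycle (L , u , v , p , e , uL , ≤-trans k≤H long)
      -- With this value `k ∸ a` is the size of `H`, so the deletions counted may stop exactly when
      -- that many vertices remain.
      a = k ∸ length H
      larger = disintegrate G a (allFin n)
      H′ = proj₁ larger
      uH′ : Unique H′
      uH′ = disintegrates-unique G (proj₁ (proj₂ larger)) uV
      ⊆H : ∀ {X} → Unique X → Core G a X → X ⊆ H
      ⊆H = largerCore-⊆ k≤n H<k dis core uH complete t+2≤
      H′⊆H : H′ ⊆ H
      H′⊆H = ⊆H uH′ (proj₂ (proj₂ larger))
      2≤a : 2 ≤ a
      -- For `a` at most 1 the minimum degree 2 makes the whole vertex set a core, hence a part of
      -- `H`, which has fewer than k ≤ n vertices.
      2≤a = ≰⇒> λ a≤1 → <⇒≱ H<k (≤-trans k≤n (subst (_≤ length H) (length-tabulate (λ i → i))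
        (length-⊆ uV (⊆H uV λ m → ≤-trans (s≤s a≤1) (twoConnected⇒core conn m)))))
      a≤t : a ≤ t
      a≤t = m≤n+o⇒m∸n≤o k (length H) (begin
        k                          ≤⟨ k≤2t+2 ⟩
        suc t + suc t              ≡⟨ +-comm (suc t) (suc t) ⟩
        suc (t + suc t)            ≡⟨ cong suc (+-suc t t) ⟩
        suc (suc t) + t            ≤⟨ +-monoˡ-≤ t t+2≤ ⟩
        length H + t               ∎)
        where open ≤-Reasoning

theorem1p4 : (s n k : ℕ) → 2 ≤ s → 5 ≤ k → k ≤ n →
    (G : Graph n) → TwoConnected G → CircumferenceLessThan G k →
    N s G ≤ (f s n k 2 ⊔ f s n k ((k ∸ 1) / 2))
theorem1p4 (suc zero) n k (s≤s ())
theorem1p4 (suc (suc r)) n (suc k′) 2≤s 5≤k k≤n G conn circ = go (suc (nonEdges G)) G ≤-refl conn circ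
  where
  s = suc (suc r)
  k = suc k′
  t = k′ / 2
  M = f s n k 2 ⊔ f s n k t

  3≤k : 3 ≤ k
  3≤k = ≤-trans (s≤s (s≤s (s≤s z≤n))) 5≤k
  t≤k : t ≤ k
  t≤k = ≤-trans (≤-trans (m≤m*n t 2) (m/n*n≤m k′ 2)) (n≤1+n k′)
  k≤2t+2 : k ≤ suc t + suc t
  k≤2t+2 = begin
    suc k′                      ≡⟨ cong suc (m≡m%n+[m/n]*n k′ 2) ⟩
    suc (k′ % 2 + t * 2)        ≤⟨ +-monoˡ-≤ (t * 2) (m%n<n k′ 2) ⟩
    2 + t * 2                   ≡⟨ double t ⟩
    suc t + suc t               ∎
    where
    open ≤-Reasoning
    double : ∀ t → 2 + t * 2 ≡ suc t + suc t
    double = solve-∀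

  go : ∀ fuel (G : Graph n) → nonEdges G < fuel → TwoConnected G → CircumferenceLessThan G k → N s G ≤ M
  go (suc fuel) G (s≤s fewer) conn circ with N s G ≤? M
  ... | yes N≤M = N≤M
  ... | no N≰M = ≤-trans (N≤cliques G s) (conclude (Saturated.cliques-bound G conn noCycle saturated (suc r)
        k≤n (≤-trans (n≤1+n 2) 3≤k) t≤k k≤2t+2))
    where
    noCycle : ¬ LongCycle G k
    noCycle c with longCycle⇒ G 3≤k c
    ... | ℓ , k≤ℓ , cyc = <⇒≱ (circ ℓ cyc) k≤ℓ
    -- Without a long path, `G⁺` keeps the small circumference and has fewer missing edges, so the
    -- bound holds for it and, cliques being only gained, for `G`, contrary to `N≰M`.
    saturated : ∀ {x y} (x≢y : x ≢ y) → ¬ Adj G x y → ¬ ¬ AddEdge.LongPath G x y x≢y k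
    saturated {x} {y} x≢y x≁y noPath = N≰M (≤-trans (N-mono {G = G} {G⁺} s old)
      (go fuel G⁺ (<-≤-trans (nonEdges-addEdge G x≢y x≁y) fewer)
        (twoConnected⁺ conn) (circumference⁺ 3≤k circ noPath)))
      where open AddEdge G x y x≢y
    conclude : (∃ λ a → (a ≡ t ⊎ 2 ≤ a × a ≤ t) × cliques G s (allFin n) ≤ f s n k a) → cliques G s (allFin n) ≤ M
    conclude (a , inj₁ refl , bound) = ≤-trans bound (m≤n⊔m (f s n k 2) (f s n k t))
    conclude (a , inj₂ (2≤a , a≤t) , bound) = ≤-trans bound (f-quasiconvex r n k 2≤a a≤t)
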